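{- For any constant $\epsilon>0$, there is a polynomial-time $\left(\frac13-\epsilon\right)$-approximation algorithm for maximizing a non-negative symmetric submodular function over bases of any matroid; that is, given a matroid $\mathcal{M}$ on a finite ground set $V$ with set of bases $\mathcal{B}(\mathcal{M})$ and a non-negative symmetric submodular function $f:2^V\to\mathbb{R}_{\ge0}$, the algorithm returns $S\in\mathcal{B}(\mathcal{M})$ with $$f(S)\ \ge\ \left(\tfrac13-\epsilon\right)\cdot\max\{f(T)\ :\ T\in\mathcal{B}(\mathcal{M})\}.$$
   Context: A function $f:2^V\to\mathbb{R}$ is submodular if $f(S\cup T)+f(S\cap T)\le f(S)+f(T)$ for all $S,T\subseteq V$; it is symmetric if $f(S)=f(V\setminus S)$ for all $S\subseteq V$. A base of a matroid is a maximal independent set. The function $f$ is accessed through a value oracle (given $S$, returns $f(S)$) and the matroid through an independence oracle; oracle calls count as single steps, and polynomial time means polynomial in the input size for fixed $\epsilon$. -}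

module Defs where

open import Algebra.Bundles using (CommutativeRing)
open import Data.Bool.Base using (Bool; true; false; not; if_then_else_; _∧_)
open import Data.Fin.Base using (toℕ)
open import Data.Fin.Subset using (Subset; ⊥; _∈_; _∉_; _⊆_; _∪_; _∩_; ∁; ⁅_⁆; ∣_∣)
open import Data.Nat.Base as ℕ using (ℕ; suc; _≡ᵇ_; _<ᵇ_)
open import Data.Product.Base using (∃; ∃-syntax; _×_)
open import Data.Vec.Base using (tabulate)
open import Level using (Level; _⊔_; 0ℓ) renaming (suc to lsuc)
open import Relation.Binary.Core using (Rel)
open import Relation.Binary.Construct.StrictToNonStrict as ToNonStrict using ()
open import Relation.Binary.PropositionalEquality.Core using (_≡_)
open import Relation.Binary.Structures using (IsStrictTotalOrder)
open import Relation.Nullary.Decidable.Core using (does)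
open import Relation.Nullary.Negation.Core using (¬_)
open import Relation.Unary using (Pred; Decidable)

-- Classically ℝ is, up to isomorphism, the only model of this record.
-- The supremum is approximated from within its set by a witness; this is
-- classically the same as being a least upper bound.  The value of _⁻¹ at
-- zero is unconstrained.

record Reals (c ℓ₁ ℓ₂ : Level) : Set (lsuc (c ⊔ ℓ₁ ⊔ ℓ₂)) where
  infix 4 _<_
  infix 8 _⁻¹
  field
    commutativeRing : CommutativeRing c ℓ₁

  open CommutativeRing commutativeRing public

  field
    _<_                : Rel Carrier ℓ₂
    isStrictTotalOrder : IsStrictTotalOrder _≈_ _<_
    0<1                : 0# < 1#
    +-monoˡ-<          : ∀ z {x y} → x < y → x + z < y + z
    *-pos              : ∀ {x y} → 0# < x → 0# < y → 0# < x * y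
    _⁻¹                : Carrier → Carrier
    ⁻¹-inverseʳ        : ∀ x → ¬ (x ≈ 0#) → x * x ⁻¹ ≈ 1#

  open ToNonStrict _≈_ _<_ public using (_≤_)
  open IsStrictTotalOrder isStrictTotalOrder public using (compare; _<?_)

  field
    supremum : (P : Pred Carrier (c ⊔ ℓ₁ ⊔ ℓ₂)) → ∃ P →
               (∃[ b ] (∀ x → P x → x ≤ b)) →
               ∃[ s ] (∀ x → P x → x ≤ s) ×
                      (∀ b → b < s → ∃[ x ] P x × b < x)

record Matroid (n : ℕ) : Set₁ where
  field
    Independent  : Pred (Subset n) 0ℓ
    independent? : Decidable Independent
    empty        : Independent ⊥
    hereditary   : ∀ {S T} → S ⊆ T → Independent T → Independent S
    augmentation : ∀ {S T} → Independent S → Independent T →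
                   ∣ S ∣ ℕ.< ∣ T ∣ →
                   ∃[ x ] x ∈ T × x ∉ S × Independent (S ∪ ⁅ x ⁆)

  IsBase : Pred (Subset n) 0ℓ
  IsBase B = Independent B × (∀ S → Independent S → B ⊆ S → S ≡ B)

module _ {c ℓ₁ ℓ₂} (ℝ : Reals c ℓ₁ ℓ₂) {n : ℕ} where
  open Reals ℝ

  NonNegative : (Subset n → Carrier) → Set (ℓ₁ ⊔ ℓ₂)
  NonNegative f = ∀ S → 0# ≤ f S

  Submodular : (Subset n → Carrier) → Set (ℓ₁ ⊔ ℓ₂)
  Submodular f = ∀ S T → f (S ∪ T) + f (S ∩ T) ≤ f S + f T

  SymmetricFunction : (Subset n → Carrier) → Set ℓ₁
  SymmetricFunction f = ∀ S → f S ≈ f (∁ S)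

  IsMaximumOver : Pred (Subset n) 0ℓ → (Subset n → Carrier) →
                  Carrier → Set (ℓ₁ ⊔ ℓ₂)
  IsMaximumOver P f m = (∃[ T ] P T × f T ≈ m) × (∀ T → P T → f T ≤ m)

-- Programs for a random access machine whose memory consists of arrays
-- (named by numbers, indexed by numbers) of natural numbers and of reals.
-- The syntax mentions neither the ground set nor the oracles: one program
-- serves all instances, and it sees an instance only through the size of
-- the ground set and the two kinds of oracle call.
--
-- There is no multiplication: at unit cost it would produce, in
-- polynomially many steps, numbers of exponential bit length.  With
-- additive operations only, a run of t steps on rational oracle values
-- can be carried out with bit cost polynomial in t, n and their length.

infix  9 _[_]
infixl 6 _⊕_ _⊖_

data NatExp : Set where
  lit     : ℕ → NatExp
  size    : NatExp
  _[_]    : ℕ → NatExp → NatExp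
  _⊕_ _⊖_ : NatExp → NatExp → NatExp

data RealExp : Set where
  zeroᴿ oneᴿ : RealExp
  _[_]       : ℕ → NatExp → RealExp
  _⊕_ _⊖_    : RealExp → RealExp → RealExp

infix 5 _≺_ _≺ᴿ_

data Test : Set where
  _≺_  : NatExp → NatExp → Test
  _≺ᴿ_ : RealExp → RealExp → Test

infix  4 _[_]≔_ _[_]≔ᴿ_ _[_]≔value_ _[_]≔independent_
infixr 3 _⨟_

-- The argument of an oracle call is the name of the array that holds the
-- characteristic vector of the queried set.

data Program : Set where
  skip               : Program
  _[_]≔_             : ℕ → NatExp → NatExp → Program
  _[_]≔ᴿ_            : ℕ → NatExp → RealExp → Program
  _[_]≔value_        : ℕ → NatExp → ℕ → Program
  _[_]≔independent_  : ℕ → NatExp → ℕ → Program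
  _⨟_                : Program → Program → Program
  ifᴾ_then_else_     : Test → Program → Program → Program
  while_loop_        : Test → Program → Program

update : ∀ {a} {A : Set a} → (ℕ → ℕ → A) → ℕ → ℕ → A → (ℕ → ℕ → A)
update m a i v b j = if (a ≡ᵇ b) ∧ (i ≡ᵇ j) then v else m b j

-- Nonzero entries mark the members of the set.
decode : ∀ n → (ℕ → ℕ) → Subset n
decode n v = tabulate (λ i → 0 <ᵇ v (toℕ i))

module Execution {c ℓ₁ ℓ₂} (ℝ : Reals c ℓ₁ ℓ₂) {n : ℕ}
                 (M : Matroid n) (f : Subset n → Reals.Carrier ℝ) where
  open Reals ℝ
  open Matroid M

  record State : Set c where
    constructor ⟪_,_⟫
    field
      nats  : ℕ → ℕ → ℕ
      reals : ℕ → ℕ → Carrier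

  open State

  initial : State
  initial = ⟪ (λ _ _ → 0) , (λ _ _ → 0#) ⟫

  evalℕ : NatExp → State → ℕ
  evalℕ (lit k)    σ = k
  evalℕ size       σ = n
  evalℕ (a [ e ])  σ = nats σ a (evalℕ e σ)
  evalℕ (e₁ ⊕ e₂) σ = evalℕ e₁ σ ℕ.+ evalℕ e₂ σ
  evalℕ (e₁ ⊖ e₂) σ = evalℕ e₁ σ ℕ.∸ evalℕ e₂ σ

  evalᴿ : RealExp → State → Carrier
  evalᴿ zeroᴿ      σ = 0#
  evalᴿ oneᴿ       σ = 1#
  evalᴿ (a [ e ])  σ = reals σ a (evalℕ e σ)
  evalᴿ (e₁ ⊕ e₂) σ = evalᴿ e₁ σ + evalᴿ e₂ σ
  evalᴿ (e₁ ⊖ e₂) σ = evalᴿ e₁ σ - evalᴿ e₂ σ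

  test : Test → State → Bool
  test (e₁ ≺ e₂)  σ = evalℕ e₁ σ <ᵇ evalℕ e₂ σ
  test (e₁ ≺ᴿ e₂) σ = does (evalᴿ e₁ σ <? evalᴿ e₂ σ)

  setℕ : ℕ → NatExp → ℕ → State → State
  setℕ a e v σ = ⟪ update (nats σ) a (evalℕ e σ) v , reals σ ⟫

  setᴿ : ℕ → NatExp → Carrier → State → State
  setᴿ a e v σ = ⟪ nats σ , update (reals σ) a (evalℕ e σ) v ⟫

  query : ℕ → State → Subset n
  query b σ = decode n (nats σ b)

  infix 2 _,_⇓_after_

  -- p , σ ⇓ τ after t: started in σ, p halts in τ after t steps.
  -- Expressions count as a single step, since their sizes are bounded by
  -- that of the program.
  data _,_⇓_after_ : Program → State → State → ℕ → Set c where
    skip        : ∀ {σ} → skip , σ ⇓ σ after 1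
    assignℕ     : ∀ {a e e′ σ} →
                  (a [ e ]≔ e′) , σ ⇓ setℕ a e (evalℕ e′ σ) σ after 1
    assignᴿ     : ∀ {a e r σ} →
                  (a [ e ]≔ᴿ r) , σ ⇓ setᴿ a e (evalᴿ r σ) σ after 1
    value       : ∀ {a e b σ} →
                  (a [ e ]≔value b) , σ ⇓ setᴿ a e (f (query b σ)) σ after 1
    independent : ∀ {a e b σ} →
                  (a [ e ]≔independent b) , σ ⇓
                    setℕ a e (if does (independent? (query b σ)) then 1 else 0) σ
                    after 1
    sequence    : ∀ {p q σ τ υ s t} →
                  p , σ ⇓ τ after s → q , τ ⇓ υ after t →
                  (p ⨟ q) , σ ⇓ υ after (s ℕ.+ t)
    if-true     : ∀ {b p q σ τ t} → test b σ ≡ true →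
                  p , σ ⇓ τ after t →
                  (ifᴾ b then p else q) , σ ⇓ τ after suc t
    if-false    : ∀ {b p q σ τ t} → test b σ ≡ false →
                  q , σ ⇓ τ after t →
                  (ifᴾ b then p else q) , σ ⇓ τ after suc t
    while-true  : ∀ {b p σ τ υ s t} → test b σ ≡ true →
                  p , σ ⇓ τ after s → (while b loop p) , τ ⇓ υ after t →
                  (while b loop p) , σ ⇓ υ after suc (s ℕ.+ t)
    while-false : ∀ {b p σ} → test b σ ≡ false →
                  (while b loop p) , σ ⇓ σ after 1

  -- The output is the set held by array 0 on halting.
  Returns : Program → Subset n → ℕ → Set c
  Returns p S t = ∃[ τ ] (p , initial ⇓ τ after t) × query 0 τ ≡ S

module _ {c ℓ₁ ℓ₂} (ℝ : Reals c ℓ₁ ℓ₂) where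
  open Reals ℝ

  IsPolynomialTimeApproximation : Carrier → Program → Set (lsuc 0ℓ ⊔ c ⊔ ℓ₁ ⊔ ℓ₂)
  IsPolynomialTimeApproximation α A =
    ∃[ k ] ∃[ d ]
    (∀ n (M : Matroid n) (f : Subset n → Carrier) →
     NonNegative ℝ f → SymmetricFunction ℝ f → Submodular ℝ f →
     let open Matroid M; open Execution ℝ M f in
     ∃[ S ] ∃[ t ]
       Returns A S t × t ℕ.≤ k ℕ.* n ℕ.^ d ℕ.+ k ×
       IsBase S ×
       (∃[ opt ] IsMaximumOver ℝ IsBase f opt × α * opt ≤ f S))

{-# OPTIONS --safe #-}

-- The algorithm is local search over bases by steepest ascent: starting from
-- a greedy base, T = K (n + 1) times the best single exchange is made, where
-- K ε ≥ 1.  For bases S and C, submodularity and symmetric exchange give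
--
--   f(S ∪ C) + f(S ∩ C) ≤ 2 f(S) + |C ∖ S| δ,
--
-- where δ is the gain of the best exchange, and symmetry gives
-- f(C) ≤ f(S) + f(S ∪ C) + f(S ∩ C).  Hence opt ≤ 3 f(S) + n δ in every round,
-- and these bounds add up to T opt ≤ (3 T + n) f(S) for the final base S.
-- No threshold for the gain is needed, so the program only compares reals.

module Submission where

open import Defs
import Algebra.Properties.Semiring.Mult as Mult
import Algebra.Solver.Ring.NaturalCoefficients.Default as SemiringSolver
open import Data.Bool.Base using (Bool; true; false; not; if_then_else_; _∧_; _∨_)
open import Data.Bool.Properties
  using (∧-idem; ∨-idem; ∨-assoc; ∧-assoc; ∨-abs-∧; ∧-abs-∨; ∨-zeroʳ; ∨-identityʳ; T-≡)
open import Data.Fin.Base using (Fin; zero; suc; toℕ)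
open import Data.Fin.Properties using (_≟_; any?; toℕ<n; toℕ-fromℕ<; toℕ-injective)
open import Data.Fin.Subset using (Subset; inside; outside; ⊥; _∈_; _∉_; _⊆_; _∪_; _∩_; ∁; ⁅_⁆; ∣_∣)
open import Data.Fin.Subset.Properties
  using ( _∈?_; ⊆-refl; ⊆-antisym; p⊆q⇒∣p∣≤∣q∣; p⊂q⇒∣p∣<∣q∣; ∪-identityʳ; x∈p∩q⁺; x∉p⇒x∈∁p; ∣p∣≤n)
open import Data.Nat.Base as ℕ using (ℕ; zero; suc; _≡ᵇ_; _<ᵇ_; z≤n; s≤s)
import Data.Nat.Properties as ℕ
open import Data.Nat.Solver using (module +-*-Solver)
open import Data.Product.Base using (∃-syntax; _×_; _,_; proj₁; proj₂)
open import Data.Sum.Base using (_⊎_; inj₁; inj₂; [_,_]′)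
open import Data.Vec.Base using ([]; _∷_; lookup; tabulate; here; there) renaming (_[_]≔_ to _[_]↦_)
open import Data.Vec.Properties
  using ( lookup∘update; lookup∘update′; lookup-zipWith; lookup-map; lookup∘tabulate; tabulate∘lookup
        ; tabulate-cong; []≔-updates; []≔-minimal; []=⇒lookup; lookup⇒[]=)
open import Function.Base using (_∘_; case_of_)
open import Function.Bundles using (Equivalence)
open import Level using (_⊔_; 0ℓ; Lift; lift; lower)
open import Relation.Binary.Definitions using (tri<; tri≈; tri>)
open import Relation.Binary.Structures using (IsStrictTotalOrder; IsTotalOrder)
import Relation.Binary.Construct.StrictToNonStrict as ToNonStrict
open import Relation.Binary.PropositionalEquality
  using (_≡_; _≢_; refl; sym; trans; cong; cong₂; subst)
open import Relation.Nullary.Decidable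
  using (yes; no; does; _×-dec_; ¬?; dec-true; dec-false; decidable-stable)
open import Relation.Nullary.Negation using (¬_; contradiction)
open import Relation.Unary using (Pred; Decidable)

-- Both halves of the symmetric exchange matter: S - b + c has to be a move that the search has
-- tried, and C - c + b has to be a base again, so that the induction can put it in place of C while
-- S stays fixed. C thus walks towards S, one gain bound per step, and no bijection between the two
-- differences has to be constructed. The number of rounds is fixed in advance because the greedy
-- base may have value zero or a tiny fraction of opt, so that a stopping rule relative to the
-- current value would not by itself bound the number of rounds. In the sum over the rounds the
-- terms n δ telescope to at most n f(S) for the final S, and every earlier value is at most the
-- final one. With T = K (n + 1) this gives opt ≤ (3 + 1/K) f(S), and (1/3 - ε)(3 + 1/K) ≤ 1 as soon
-- as 1/K ≤ ε. Inequalities are kept free of subtraction, with f(S) + δ written as one value F, so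
-- that a solver for commutative semirings can check them.

-- Finite subsets: insertion, removal and swaps

insert remove : ∀ {n} → Subset n → Fin n → Subset n
insert S x = S [ x ]↦ inside
remove S x = S [ x ]↦ outside

swap : ∀ {n} → Subset n → Fin n → Fin n → Subset n
swap S b c = insert (remove S b) c

module _ {n : ℕ} where

  lookup-ext : {S T : Subset n} → (∀ x → lookup S x ≡ lookup T x) → S ≡ T
  lookup-ext {S} {T} eq = trans (sym (tabulate∘lookup S)) (trans (tabulate-cong eq) (tabulate∘lookup T))

  lookup-update : ∀ (S : Subset n) x v y →
                  lookup (S [ x ]↦ v) y ≡ (if does (y ≟ x) then v else lookup S y)
  lookup-update S x v y with y ≟ x
  ... | yes refl = lookup∘update x S v
  ... | no y≢x   = lookup∘update′ y≢x S v

  ∉⇒lookup : ∀ {S : Subset n} {x} → x ∉ S → lookup S x ≡ outside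
  ∉⇒lookup {S} {x} x∉S with lookup S x in eq
  ... | true  = contradiction (lookup⇒[]= x S eq) x∉S
  ... | false = refl

  lookup⇒∉ : ∀ {S : Subset n} {x} → lookup S x ≡ outside → x ∉ S
  lookup⇒∉ eq x∈S with trans (sym ([]=⇒lookup x∈S)) eq
  ... | ()

  x∈insert : ∀ (S : Subset n) x → x ∈ insert S x
  x∈insert S x = []≔-updates S x

  ∈-insert⁺ : ∀ {S : Subset n} {x y} → y ∈ S → y ∈ insert S x
  ∈-insert⁺ {S} {x} {y} y∈S with y ≟ x
  ... | yes refl = x∈insert S x
  ... | no y≢x   = []≔-minimal S y x y≢x y∈S

  ∈-insert⁻ : ∀ {S : Subset n} {x y} → y ∈ insert S x → y ≡ x ⊎ y ∈ S
  ∈-insert⁻ {S} {x} {y} y∈ with y ≟ x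
  ... | yes y≡x = inj₁ y≡x
  ... | no y≢x  =
    inj₂ (lookup⇒[]= y S (trans (sym (lookup∘update′ y≢x S inside)) ([]=⇒lookup y∈)))

  ∈-remove⁺ : ∀ {S : Subset n} {x y} → y ∈ S → y ≢ x → y ∈ remove S x
  ∈-remove⁺ {S} {x} {y} y∈S y≢x = []≔-minimal S y x y≢x y∈S

  x∉remove : ∀ (S : Subset n) x → x ∉ remove S x
  x∉remove S x = lookup⇒∉ (lookup∘update x S outside)

  ∈-remove⁻ : ∀ {S : Subset n} {x y} → y ∈ remove S x → y ≢ x × y ∈ S
  ∈-remove⁻ {S} {x} {y} y∈ with y ≟ x
  ... | yes refl = contradiction y∈ (x∉remove S x)
  ... | no y≢x   =
    y≢x , lookup⇒[]= y S (trans (sym (lookup∘update′ y≢x S outside)) ([]=⇒lookup y∈))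

  insert-⊆ : ∀ {S T : Subset n} {x} → S ⊆ T → x ∈ T → insert S x ⊆ T
  insert-⊆ S⊆T x∈T y∈ with ∈-insert⁻ y∈
  ... | inj₁ refl = x∈T
  ... | inj₂ y∈S  = S⊆T y∈S

  ∈⇒insert≡ : ∀ {S : Subset n} {x} → x ∈ S → insert S x ≡ S
  ∈⇒insert≡ x∈S = ⊆-antisym (insert-⊆ ⊆-refl x∈S) ∈-insert⁺

  ⊆∧∣∣≤⇒≡ : ∀ {S T : Subset n} → S ⊆ T → ∣ T ∣ ℕ.≤ ∣ S ∣ → S ≡ T
  ⊆∧∣∣≤⇒≡ {S} {T} S⊆T ∣T∣≤∣S∣ = ⊆-antisym S⊆T T⊆S
    where
    T⊆S : T ⊆ S
    T⊆S {x} x∈T with x ∈? S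
    ... | yes x∈S = x∈S
    ... | no x∉S  = contradiction (p⊂q⇒∣p∣<∣q∣ (S⊆T , x , x∈T , x∉S)) (ℕ.≤⇒≯ ∣T∣≤∣S∣)

  fromPredicate : ∀ {ℓ} {P : Pred (Fin n) ℓ} → Decidable P → Subset n
  fromPredicate P? = tabulate (does ∘ P?)

  ∈-fromPredicate⁺ : ∀ {ℓ} {P : Pred (Fin n) ℓ} (P? : Decidable P) {x} → P x → x ∈ fromPredicate P?
  ∈-fromPredicate⁺ P? {x} px =
    lookup⇒[]= x _ (trans (lookup∘tabulate (does ∘ P?) x) (dec-true (P? x) px))

  ∈-fromPredicate⁻ : ∀ {ℓ} {P : Pred (Fin n) ℓ} (P? : Decidable P) {x} → x ∈ fromPredicate P? → P x
  ∈-fromPredicate⁻ P? {x} x∈ with P? x in eq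
  ... | yes px = px
  ... | no ¬px = contradiction x∈ (lookup⇒∉ (trans (lookup∘tabulate (does ∘ P?) x) (dec-false (P? x) ¬px)))

∪⁅⁆≡insert : ∀ {n} (S : Subset n) x → S ∪ ⁅ x ⁆ ≡ insert S x
∪⁅⁆≡insert (s ∷ S) zero    = cong₂ _∷_ (∨-zeroʳ s) (∪-identityʳ S)
∪⁅⁆≡insert (s ∷ S) (suc x) = cong₂ _∷_ (∨-identityʳ s) (∪⁅⁆≡insert S x)

∣insert∣ : ∀ {n} {S : Subset n} {x} → x ∉ S → ∣ insert S x ∣ ≡ suc ∣ S ∣
∣insert∣ {S = true  ∷ S} {zero}  x∉ = contradiction here x∉
∣insert∣ {S = false ∷ S} {zero}  x∉ = refl
∣insert∣ {S = true  ∷ S} {suc x} x∉ = cong suc (∣insert∣ (x∉ ∘ there))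
∣insert∣ {S = false ∷ S} {suc x} x∉ = ∣insert∣ (x∉ ∘ there)

∣remove∣ : ∀ {n} {S : Subset n} {x} → x ∈ S → suc ∣ remove S x ∣ ≡ ∣ S ∣
∣remove∣ {S = true  ∷ S} here       = refl
∣remove∣ {S = true  ∷ S} (there x∈) = cong suc (∣remove∣ x∈)
∣remove∣ {S = false ∷ S} (there x∈) = ∣remove∣ x∈

module _ {n : ℕ} where

  ∣swap∣ : ∀ {S : Subset n} {b c} → b ∈ S → c ∉ S → ∣ swap S b c ∣ ≡ ∣ S ∣
  ∣swap∣ b∈S c∉S = trans (∣insert∣ (c∉S ∘ proj₂ ∘ ∈-remove⁻)) (∣remove∣ b∈S)

  lookup-∪ : ∀ (S T : Subset n) x → lookup (S ∪ T) x ≡ lookup S x ∨ lookup T x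
  lookup-∪ S T x = lookup-zipWith _∨_ x S T

  lookup-∩ : ∀ (S T : Subset n) x → lookup (S ∩ T) x ≡ lookup S x ∧ lookup T x
  lookup-∩ S T x = lookup-zipWith _∧_ x S T

  lookup-∁ : ∀ (S : Subset n) x → lookup (∁ S) x ≡ not (lookup S x)
  lookup-∁ S x = lookup-map x not S

  lookup-swap : ∀ (S : Subset n) b c x →
    lookup (swap S b c) x ≡
      (if does (x ≟ c) then inside else if does (x ≟ b) then outside else lookup S x)
  lookup-swap S b c x =
    trans (lookup-update (remove S b) c inside x)
          (cong (if does (x ≟ c) then inside else_) (lookup-update S b outside x))

  remove-insert : ∀ {S : Subset n} {x} → x ∉ S → remove (insert S x) x ≡ S
  remove-insert {S} {x} x∉S = lookup-ext eq
    where
    eq : ∀ y → lookup (remove (insert S x) x) y ≡ lookup S y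
    eq y rewrite lookup-update (insert S x) x outside y | lookup-update S x inside y with y ≟ x
    ... | yes refl = sym (∉⇒lookup x∉S)
    ... | no _     = refl

  swap-inverse : ∀ {S : Subset n} {b c} → b ∈ S → c ∉ S → swap (swap S b c) c b ≡ S
  swap-inverse {S} {b} {c} b∈S c∉S = lookup-ext eq
    where
    eq : ∀ x → lookup (swap (swap S b c) c b) x ≡ lookup S x
    eq x rewrite lookup-swap (swap S b c) c b x | lookup-swap S b c x with x ≟ b | x ≟ c
    ... | yes refl | _        = sym ([]=⇒lookup b∈S)
    ... | no _     | yes refl = sym (∉⇒lookup c∉S)
    ... | no _     | no _     = refl

  module _ {S C : Subset n} {b c : Fin n} (b∈S : b ∈ S) (b∉C : b ∉ C) (c∈C : c ∈ C) (c∉S : c ∉ S) where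

    private
      C′ = swap C c b

      Sb = []=⇒lookup b∈S
      Cb = ∉⇒lookup b∉C
      Cc = []=⇒lookup c∈C
      Sc = ∉⇒lookup c∉S

    -- The six identities from here to `remove-∩-∩` form three pairs; each pair supplies the union
    -- and the intersection for one submodular inequality in `∪∩-bound`.
    swap-∪ : swap S b c ∪ S ≡ insert S c
    swap-∪ = lookup-ext eq
      where
      eq : ∀ x → lookup (swap S b c ∪ S) x ≡ lookup (insert S c) x
      eq x rewrite lookup-∪ (swap S b c) S x | lookup-swap S b c x | lookup-update S c inside x
        with x ≟ c | x ≟ b
      ... | yes _ | _        = refl
      ... | no _  | yes refl = refl
      ... | no _  | no _     = ∨-idem _

    swap-∩ : swap S b c ∩ S ≡ remove S b
    swap-∩ = lookup-ext eq
      where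
      eq : ∀ x → lookup (swap S b c ∩ S) x ≡ lookup (remove S b) x
      eq x rewrite lookup-∩ (swap S b c) S x | lookup-swap S b c x | lookup-update S b outside x
        with x ≟ c | x ≟ b
      ... | yes refl | yes refl = Sc
      ... | yes refl | no _     = refl
      ... | no _     | yes _    = refl
      ... | no _     | no _     = ∧-idem _

    insert-∪-∪ : insert S c ∪ (S ∪ C′) ≡ S ∪ C
    insert-∪-∪ = lookup-ext eq
      where
      eq : ∀ x → lookup (insert S c ∪ (S ∪ C′)) x ≡ lookup (S ∪ C) x
      eq x rewrite lookup-∪ (insert S c) (S ∪ C′) x | lookup-∪ S C′ x | lookup-∪ S C x
                 | lookup-swap C c b x | lookup-update S c inside x
        with x ≟ c | x ≟ b
      ... | yes refl | _        rewrite Sc | Cc = refl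
      ... | no _     | yes refl rewrite Sb = refl
      ... | no _     | no _     = trans (sym (∨-assoc (lookup S x) _ _)) (cong (_∨ lookup C x) (∨-idem _))

    insert-∩-∪ : insert S c ∩ (S ∪ C′) ≡ S
    insert-∩-∪ = lookup-ext eq
      where
      eq : ∀ x → lookup (insert S c ∩ (S ∪ C′)) x ≡ lookup S x
      eq x rewrite lookup-∩ (insert S c) (S ∪ C′) x | lookup-∪ S C′ x
                 | lookup-swap C c b x | lookup-update S c inside x
        with x ≟ c | x ≟ b
      ... | yes refl | yes refl = contradiction b∈S c∉S
      ... | yes refl | no _     rewrite Sc = refl
      ... | no _     | yes refl rewrite Sb = refl
      ... | no _     | no _     = ∧-abs-∨ (lookup S x) _

    remove-∪-∩ : remove S b ∪ (S ∩ C′) ≡ S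
    remove-∪-∩ = lookup-ext eq
      where
      eq : ∀ x → lookup (remove S b ∪ (S ∩ C′)) x ≡ lookup S x
      eq x rewrite lookup-∪ (remove S b) (S ∩ C′) x | lookup-∩ S C′ x
                 | lookup-swap C c b x | lookup-update S b outside x
        with x ≟ c | x ≟ b
      ... | yes refl | yes refl = contradiction b∈S c∉S
      ... | yes refl | no _     rewrite Sc = refl
      ... | no _     | yes refl rewrite Sb = refl
      ... | no _     | no _     = ∨-abs-∧ (lookup S x) _

    remove-∩-∩ : remove S b ∩ (S ∩ C′) ≡ S ∩ C
    remove-∩-∩ = lookup-ext eq
      where
      eq : ∀ x → lookup (remove S b ∩ (S ∩ C′)) x ≡ lookup (S ∩ C) x
      eq x rewrite lookup-∩ (remove S b) (S ∩ C′) x | lookup-∩ S C′ x | lookup-∩ S C x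
                 | lookup-swap C c b x | lookup-update S b outside x
        with x ≟ c | x ≟ b
      ... | yes refl | yes refl = contradiction b∈S c∉S
      ... | yes refl | no _     rewrite Sc = refl
      ... | no _     | yes refl rewrite Sb | Cb = refl
      ... | no _     | no _     = trans (sym (∧-assoc (lookup S x) _ _)) (cong (_∧ lookup C x) (∧-idem _))

    -- The incoming b lies in S, so only the loss of c is visible outside S. This is the measure
    -- that decreases in `∪∩-bound`.
    swap-∩-∁ : C′ ∩ ∁ S ≡ remove (C ∩ ∁ S) c
    swap-∩-∁ = lookup-ext eq
      where
      eq : ∀ x → lookup (C′ ∩ ∁ S) x ≡ lookup (remove (C ∩ ∁ S) c) x
      eq x rewrite lookup-update (C ∩ ∁ S) c outside x
                 | lookup-∩ C′ (∁ S) x | lookup-∩ C (∁ S) x | lookup-∁ S x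
                 | lookup-swap C c b x
        with x ≟ c | x ≟ b
      ... | yes refl | yes refl = contradiction b∈S c∉S
      ... | yes refl | no _     = refl
      ... | no _     | yes refl rewrite Sb | Cb = refl
      ... | no _     | no _     = refl

-- Matroids: symmetric exchange and bases as independent sets of maximum size

module _ {n : ℕ} (M : Matroid n) where
  open Matroid M

  augment : ∀ {S T} → Independent S → Independent T → ∣ S ∣ ℕ.< ∣ T ∣ →
            ∃[ x ] x ∈ T × x ∉ S × Independent (insert S x)
  augment {S} indS indT S<T with augmentation indS indT S<T
  ... | x , x∈T , x∉S , ind = x , x∈T , x∉S , subst Independent (∪⁅⁆≡insert S x) ind

  -- Repeated augmentation by elements of T. The origin of each element of U is recorded because
  -- `symmetricExchange` finds the exchanged element through it.
  extend : ∀ {S T} → Independent S → Independent T → ∣ S ∣ ℕ.≤ ∣ T ∣ →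
           ∃[ U ] Independent U × S ⊆ U × (∀ {x} → x ∈ U → x ∈ S ⊎ x ∈ T) × ∣ U ∣ ≡ ∣ T ∣
  extend {T = T} indS indT S≤T = go _ indS (sym (ℕ.m∸n+n≡m S≤T))
    where
    go : ∀ k {S} → Independent S → ∣ T ∣ ≡ k ℕ.+ ∣ S ∣ →
         ∃[ U ] Independent U × S ⊆ U × (∀ {x} → x ∈ U → x ∈ S ⊎ x ∈ T) × ∣ U ∣ ≡ ∣ T ∣
    go zero    {S} indS eq = S , indS , ⊆-refl , inj₁ , sym eq
    go (suc k) {S} indS eq
      with augment indS indT (ℕ.≤-trans (ℕ.s≤s (ℕ.m≤n+m ∣ S ∣ k)) (ℕ.≤-reflexive (sym eq)))
    ... | x , x∈T , x∉S , ind
      with go k ind (trans eq (trans (sym (ℕ.+-suc k ∣ S ∣)) (cong (k ℕ.+_) (sym (∣insert∣ x∉S)))))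
    ...   | U , indU , S+x⊆U , U⊆ , ∣U∣ =
      U , indU , S+x⊆U ∘ ∈-insert⁺ , split , ∣U∣
      where
      split : ∀ {y} → y ∈ U → y ∈ S ⊎ y ∈ T
      split y∈U with U⊆ y∈U
      ... | inj₂ y∈T = inj₂ y∈T
      ... | inj₁ y∈ with ∈-insert⁻ y∈
      ...   | inj₁ refl = inj₂ x∈T
      ...   | inj₂ y∈S  = inj₁ y∈S

  -- The set A of all elements of C that b can replace is extended to a set J
  -- of full size inside A ∪ S.  If J avoids b it augments S − b by an
  -- element of A.  If it contains b then A + b is independent, and extending
  -- it within C + b leaves out an element of A.
  symmetricExchange : ∀ {S C} → Independent S → Independent C → ∣ S ∣ ≡ ∣ C ∣ →
    ∀ {b} → b ∈ S → b ∉ C →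
    ∃[ c ] c ∈ C × c ∉ S × Independent (swap S b c) × Independent (swap C c b)
  symmetricExchange {S} {C} indS indC ∣S∣≡∣C∣ {b} b∈S b∉C =
    exchange (extend indA indS ∣A∣≤∣S∣)
    where
    replaceable? : Decidable (λ c → c ∈ C × Independent (swap C c b))
    replaceable? c = (c ∈? C) ×-dec independent? (swap C c b)

    A : Subset n
    A = fromPredicate replaceable?

    A⊆C : A ⊆ C
    A⊆C = proj₁ ∘ ∈-fromPredicate⁻ replaceable?

    indA : Independent A
    indA = hereditary A⊆C indC

    ∣A∣≤∣S∣ : ∣ A ∣ ℕ.≤ ∣ S ∣
    ∣A∣≤∣S∣ = ℕ.≤-trans (p⊆q⇒∣p∣≤∣q∣ A⊆C) (ℕ.≤-reflexive (sym ∣S∣≡∣C∣))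

    A+b-dependent : ∣ insert A b ∣ ℕ.≤ ∣ C ∣ → ¬ Independent (insert A b)
    A+b-dependent ∣A+b∣≤∣C∣ ind with extend ind indC ∣A+b∣≤∣C∣
    ... | L , indL , A+b⊆L , L⊆ , ∣L∣≡∣C∣ with any? (λ c → (c ∈? C) ×-dec ¬? (c ∈? L))
    ...   | yes (c , c∈C , c∉L) = c∉L (A+b⊆L (∈-insert⁺ (∈-fromPredicate⁺ replaceable? (c∈C , indC-c+b))))
      where
      L⊆C-c+b : L ⊆ swap C c b
      L⊆C-c+b {x} x∈L with x ≟ b
      ... | yes refl = x∈insert _ b
      ... | no x≢b   = ∈-insert⁺ (∈-remove⁺ x∈C (λ { refl → c∉L x∈L }))
        where
        x∈C : x ∈ C
        x∈C = [ [ (λ x≡b → contradiction x≡b x≢b) , A⊆C ]′ ∘ ∈-insert⁻ , (λ x∈C → x∈C) ]′ (L⊆ x∈L)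

      indC-c+b : Independent (swap C c b)
      indC-c+b = subst Independent
        (⊆∧∣∣≤⇒≡ L⊆C-c+b (ℕ.≤-reflexive (trans (∣swap∣ c∈C b∉C) (sym ∣L∣≡∣C∣)))) indL
    ...   | no C⊆L = ℕ.<-irrefl refl (ℕ.≤-trans (ℕ.≤-reflexive (sym (∣insert∣ b∉C)))
              (ℕ.≤-trans (p⊆q⇒∣p∣≤∣q∣ C+b⊆L) (ℕ.≤-reflexive ∣L∣≡∣C∣)))
      where
      C+b⊆L : insert C b ⊆ L
      C+b⊆L = insert-⊆ (λ {x} x∈C → decidable-stable (x ∈? L) (λ x∉L → C⊆L (x , x∈C , x∉L)))
                       (A+b⊆L (x∈insert A b))

    exchange : ∃[ J ] Independent J × A ⊆ J × (∀ {x} → x ∈ J → x ∈ A ⊎ x ∈ S) × ∣ J ∣ ≡ ∣ S ∣ →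
               ∃[ c ] c ∈ C × c ∉ S × Independent (swap S b c) × Independent (swap C c b)
    exchange (J , indJ , A⊆J , J⊆ , ∣J∣≡∣S∣) with b ∈? J
    ... | yes b∈J = contradiction (hereditary A+b⊆J indJ)
            (A+b-dependent (ℕ.≤-trans (p⊆q⇒∣p∣≤∣q∣ A+b⊆J) (ℕ.≤-reflexive (trans ∣J∣≡∣S∣ ∣S∣≡∣C∣))))
      where
      A+b⊆J : insert A b ⊆ J
      A+b⊆J = insert-⊆ A⊆J b∈J
    ... | no b∉J with augment (hereditary (proj₂ ∘ ∈-remove⁻) indS) indJ
                        (ℕ.≤-reflexive (trans (∣remove∣ b∈S) (sym ∣J∣≡∣S∣)))
    ...   | c , c∈J , c∉S-b , ind = c , proj₁ c∈C×ind , c∉S , ind , proj₂ c∈C×ind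
      where
      c∉S : c ∉ S
      c∉S c∈S = c∉S-b (∈-remove⁺ c∈S (λ { refl → b∉J c∈J }))
      c∈C×ind : c ∈ C × Independent (swap C c b)
      c∈C×ind = ∈-fromPredicate⁻ replaceable? ([ (λ c∈A → c∈A) , (λ c∈S → contradiction c∈S c∉S) ]′ (J⊆ c∈J))

  -- Bases described by size: in this form the property passes to any independent set of the same
  -- size, in particular to the result of an exchange.
  Maximum : Pred (Subset n) _
  Maximum S = Independent S × (∀ T → Independent T → ∣ T ∣ ℕ.≤ ∣ S ∣)

  -- By heredity a proper independent superset would already yield an independent one-element
  -- extension, and these are all that the greedy pass rules out.
  maximal⇒IsBase : ∀ {S} → Independent S → (∀ x → x ∉ S → ¬ Independent (insert S x)) → IsBase S
  maximal⇒IsBase {S} indS maximal = indS , λ T indT S⊆T →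
    ⊆-antisym (λ {x} x∈T → decidable-stable (x ∈? S) λ x∉S →
                 maximal x x∉S (hereditary (insert-⊆ S⊆T x∈T) indT))
              S⊆T

  IsBase⇒Maximum : ∀ {S} → IsBase S → Maximum S
  IsBase⇒Maximum {S} (indS , maximal) = indS , λ T indT → ℕ.≮⇒≥ λ S<T →
    case augment indS indT S<T of λ where
      (x , _ , x∉S , ind) → x∉S (subst (x ∈_) (maximal _ ind ∈-insert⁺) (x∈insert S x))

  Maximum⇒IsBase : ∀ {S} → Maximum S → IsBase S
  Maximum⇒IsBase (indS , maximum) = indS , λ T indT S⊆T → sym (⊆∧∣∣≤⇒≡ S⊆T (maximum T indT))

  Maximum-resp : ∀ {S T} → Maximum S → Independent T → ∣ T ∣ ≡ ∣ S ∣ → Maximum T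
  Maximum-resp (_ , maximum) indT ∣T∣≡∣S∣ =
    indT , λ U indU → ℕ.≤-trans (maximum U indU) (ℕ.≤-reflexive (sym ∣T∣≡∣S∣))

  Maximum⇒∣∣≡ : ∀ {S T} → Maximum S → Maximum T → ∣ S ∣ ≡ ∣ T ∣
  Maximum⇒∣∣≡ (indS , maxS) (indT , maxT) = ℕ.≤-antisym (maxT _ indS) (maxS _ indT)

-- Ordered-field arithmetic, the choice of K and the approximation ratio

module OrderedField {c ℓ₁ ℓ₂} (ℝ : Reals c ℓ₁ ℓ₂) where
  open Reals ℝ renaming (refl to ≈-refl; sym to ≈-sym; trans to ≈-trans)
  open Mult semiring public using (×-congʳ; ×-congˡ; ×-homo-1; ×-homo-+; ×-assocˡ)
    renaming (_×_ to _·_; ×-comm-* to ·-comm-*)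
  open SemiringSolver commutativeSemiring using (Polynomial; solve; _:+_; _:*_; _:=_; con)
  open IsStrictTotalOrder isStrictTotalOrder using (irrefl; <-resp-≈; <-respʳ-≈; <-respˡ-≈)
    renaming (trans to <-trans)
  open IsTotalOrder (ToNonStrict.isTotalOrder _≈_ _<_ isStrictTotalOrder) public using ()
    renaming (isPreorder to ≤-isPreorder; refl to ≤-refl; reflexive to ≤-reflexive; trans to ≤-trans; total to ≤-total)

  -- Has the shape to which `3 · x` unfolds, so that solved equations match by computation.
  triple : ∀ {k} → Polynomial k → Polynomial k
  triple x = x :+ (x :+ (x :+ con 0))

  ≤-<-trans : ∀ {x y z} → x ≤ y → y < z → x < z
  ≤-<-trans = ToNonStrict.≤-<-trans _≈_ _<_ ≈-sym <-trans <-respˡ-≈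

  <-≤-trans : ∀ {x y z} → x < y → y ≤ z → x < z
  <-≤-trans = ToNonStrict.<-≤-trans _≈_ _<_ <-trans <-respʳ-≈

  module ≤-Reasoning where
    open import Relation.Binary.Reasoning.Base.Triple
      ≤-isPreorder (IsStrictTotalOrder.asym isStrictTotalOrder) <-trans <-resp-≈
      (ToNonStrict.<⇒≤ _≈_ _<_) <-≤-trans ≤-<-trans
      public hiding (step-≈; step-≈˘)

  ≤⇒≯ : ∀ {x y} → x ≤ y → ¬ y < x
  ≤⇒≯ x≤y y<x = irrefl ≈-refl (≤-<-trans x≤y y<x)

  ≮⇒≥ : ∀ {x y} → ¬ x < y → y ≤ x
  ≮⇒≥ {x} {y} x≮y with compare x y
  ... | tri< x<y _ _ = contradiction x<y x≮y
  ... | tri≈ _ x≈y _ = inj₂ (≈-sym x≈y)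
  ... | tri> _ _ y<x = inj₁ y<x

  +-monoˡ-≤ : ∀ z {x y} → x ≤ y → x + z ≤ y + z
  +-monoˡ-≤ z (inj₁ x<y) = inj₁ (+-monoˡ-< z x<y)
  +-monoˡ-≤ z (inj₂ x≈y) = inj₂ (+-congʳ x≈y)

  +-monoʳ-≤ : ∀ z {x y} → x ≤ y → z + x ≤ z + y
  +-monoʳ-≤ z {x} {y} x≤y =
    ≤-trans (≤-reflexive (+-comm z x)) (≤-trans (+-monoˡ-≤ z x≤y) (≤-reflexive (+-comm y z)))

  +-mono-≤ : ∀ {x y u v} → x ≤ y → u ≤ v → x + u ≤ y + v
  +-mono-≤ {y = y} {u = u} x≤y u≤v = ≤-trans (+-monoˡ-≤ u x≤y) (+-monoʳ-≤ y u≤v)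

  -- The hypothesis says b − a ≈ y − x; without subtraction it is within reach
  -- of the semiring solver.
  balance : ∀ {a b x y} → a ≤ b → x + b ≈ y + a → x ≤ y
  balance {a} {b} {x} {y} a≤b x+b≈y+a = ≮⇒≥ λ y<x →
    ≤⇒≯ (≤-trans (+-monoʳ-≤ x a≤b) (≤-reflexive x+b≈y+a)) (+-monoˡ-< a y<x)

  *-nonneg : ∀ {x y} → 0# ≤ x → 0# ≤ y → 0# ≤ x * y
  *-nonneg {x} {y} (inj₁ 0<x) (inj₁ 0<y) = inj₁ (*-pos 0<x 0<y)
  *-nonneg {x} {y} (inj₂ 0≈x) _          = inj₂ (≈-trans (≈-sym (zeroˡ y)) (*-congʳ 0≈x))
  *-nonneg {x} {y} _          (inj₂ 0≈y) = inj₂ (≈-trans (≈-sym (zeroʳ x)) (*-congˡ 0≈y))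

  ·-monoʳ-≤ : ∀ n {x y} → x ≤ y → n · x ≤ n · y
  ·-monoʳ-≤ zero    x≤y = ≤-refl
  ·-monoʳ-≤ (suc n) x≤y = +-mono-≤ x≤y (·-monoʳ-≤ n x≤y)

  ·-cancelˡ-≤ : ∀ n {x y} → suc n · x ≤ suc n · y → x ≤ y
  ·-cancelˡ-≤ n nx≤ny = ≮⇒≥ λ y<x →
    ≤⇒≯ nx≤ny (<-≤-trans (+-monoˡ-< (n · _) y<x) (+-monoʳ-≤ _ (·-monoʳ-≤ n (inj₁ y<x))))

  ·-nonneg : ∀ n {x} → 0# ≤ x → 0# ≤ n · x
  ·-nonneg zero    0≤x = ≤-refl
  ·-nonneg (suc n) 0≤x = ≤-trans (≤-reflexive (≈-sym (+-identityˡ 0#))) (+-mono-≤ 0≤x (·-nonneg n 0≤x))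

  ·-monoˡ-≤ : ∀ {m n x} → 0# ≤ x → m ℕ.≤ n → m · x ≤ n · x
  ·-monoˡ-≤ {n = n} 0≤x ℕ.z≤n  = ·-nonneg n 0≤x
  ·-monoˡ-≤ 0≤x (ℕ.s≤s m≤n) = +-monoʳ-≤ _ (·-monoˡ-≤ 0≤x m≤n)

  *-monoʳ-≤ : ∀ {x y z} → 0# ≤ z → x ≤ y → z * x ≤ z * y
  *-monoʳ-≤ {x} {y} {z} 0≤z x≤y =
    balance (*-nonneg 0≤z (≤-trans (≤-reflexive (≈-sym (-‿inverseʳ x))) (+-monoˡ-≤ (- x) x≤y)))
      (≈-trans (≈-sym (distribˡ z x (y - x))) (≈-trans (*-congˡ x+[y-x]≈y) (≈-sym (+-identityʳ _))))
    where
    x+[y-x]≈y : x + (y - x) ≈ y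
    x+[y-x]≈y = ≈-trans (+-comm x (y - x)) (≈-trans (+-assoc y (- x) x)
      (≈-trans (+-congˡ (-‿inverseˡ x)) (+-identityʳ y)))

  ·-distribˡ-+ : ∀ n x y → n · (x + y) ≈ n · x + n · y
  ·-distribˡ-+ zero    x y = ≈-sym (+-identityˡ 0#)
  ·-distribˡ-+ (suc n) x y = ≈-trans (+-congˡ (·-distribˡ-+ n x y))
    (solve 4 (λ a b u v → a :+ b :+ (u :+ v) := a :+ u :+ (b :+ v)) ≈-refl x y (n · x) (n · y))

  x<x+1 : ∀ x → x < x + 1#
  x<x+1 x = <-respˡ-≈ (+-identityˡ x) (<-respʳ-≈ (+-comm 1# x) (+-monoˡ-< x 0<1))

  3# : Carrier
  3# = 1# + 1# + 1#

  0<3 : 0# < 3#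
  0<3 = <-trans 0<1 (<-trans (x<x+1 1#) (x<x+1 (1# + 1#)))

  3⁻¹-inverse : 3# * 3# ⁻¹ ≈ 1#
  3⁻¹-inverse = ⁻¹-inverseʳ 3# (λ 3≈0 → irrefl (≈-sym 3≈0) 0<3)

  -- Restricting to naturals n with n ε < 1 makes the set bounded, by ε⁻¹. An element N above s - 1,
  -- where s is the supremum, has N + 1 > s; hence N + 1 lies outside the set, which means 1 ≤ (N +
  -- 1) ε.
  archimedean : ∀ {ε} → 0# < ε → ∃[ n ] 1# ≤ n · ε
  archimedean {ε} 0<ε = suc N , ≮⇒≥ λ N+1<ε⁻¹ → ≤⇒≯ (upper _ (lift (suc N , ≈-refl , N+1<ε⁻¹))) s<N+1
    where
    Below : Pred Carrier _
    Below x = Lift (c ⊔ ℓ₁ ⊔ ℓ₂) (∃[ n ] x ≈ n · 1# × n · ε < 1#)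

    bounded : ∀ x → Below x → x ≤ ε ⁻¹
    bounded x (lift (n , x≈n , nε<1)) = ≮⇒≥ λ ε⁻¹<x → ≤⇒≯ (1≤nε (inj₁ ε⁻¹<x)) nε<1
      where
      1≤nε : ε ⁻¹ ≤ x → 1# ≤ n · ε
      1≤nε ε⁻¹≤x =
        ≤-trans (≤-reflexive (≈-sym (⁻¹-inverseʳ ε (λ ε≈0 → irrefl (≈-sym ε≈0) 0<ε))))
          (≤-trans (*-monoʳ-≤ (inj₁ 0<ε) ε⁻¹≤x)
            (≤-reflexive (≈-trans (*-congˡ x≈n) (≈-trans (·-comm-* n ε 1#) (×-congʳ n (*-identityʳ ε))))))

    least = supremum Below (0# , lift (0 , ≈-refl , 0<1)) (ε ⁻¹ , bounded)
    s     = proj₁ least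
    upper = proj₁ (proj₂ least)

    x-1+1≈x : ∀ x → x - 1# + 1# ≈ x
    x-1+1≈x x = ≈-trans (+-assoc x (- 1#) 1#) (≈-trans (+-congˡ (-‿inverseˡ 1#)) (+-identityʳ x))

    witness = proj₂ (proj₂ least) (s - 1#) (<-respʳ-≈ (x-1+1≈x s) (x<x+1 (s - 1#)))
    N = proj₁ (lower (proj₁ (proj₂ witness)))

    s<N+1 : s < suc N · 1#
    s<N+1 = <-respˡ-≈ (x-1+1≈x s) (<-respʳ-≈
      (≈-trans (+-congʳ (proj₁ (proj₂ (lower (proj₁ (proj₂ witness)))))) (+-comm (N · 1#) 1#))
      (+-monoˡ-< 1# (proj₂ (proj₂ witness))))

  -- With y = (1/3 - ε) opt and w = ε opt one has opt = 3 y + 3 w, hence K opt = 3 K w + 3 K y.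
  -- Moreover 3 y ≤ opt ≤ K w, so y ≤ 3 K w and (3 K + 1) y ≤ K opt ≤ (3 K + 1) v.
  approximation-ratio : ∀ {ε K opt v} → 0# < ε → 1# ≤ K · ε → 0# ≤ opt →
                        K · opt ≤ suc (K ℕ.* 3) · v → (3# ⁻¹ - ε) * opt ≤ v
  approximation-ratio {ε} {K} {opt} {v} 0<ε 1≤Kε 0≤opt Kopt≤ = ·-cancelˡ-≤ (K ℕ.* 3)
    (≤-trans (+-monoˡ-≤ _ (≤-trans y≤Kw Kw≤3Kw)) (≤-trans (≤-reflexive (≈-sym Kopt≈)) Kopt≤))
    where
    y = (3# ⁻¹ - ε) * opt
    w = ε * opt

    opt≈3y+3w : opt ≈ 3 · y + 3 · w
    opt≈3y+3w = begin
      opt                              ≈⟨ *-identityˡ opt ⟨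
      1# * opt                         ≈⟨ *-congʳ 3⁻¹-inverse ⟨
      3# * 3# ⁻¹ * opt                 ≈⟨ *-congʳ (*-congˡ (x-y+y≈x (3# ⁻¹))) ⟨
      3# * (3# ⁻¹ - ε + ε) * opt       ≈⟨ solve 3 (λ a e o → con 3 :* (a :+ e) :* o :=
                                            triple (a :* o) :+ triple (e :* o)) ≈-refl (3# ⁻¹ - ε) ε opt ⟩
      3 · y + 3 · w                    ∎
      where
      open import Relation.Binary.Reasoning.Setoid setoid
      x-y+y≈x : ∀ x → x - ε + ε ≈ x
      x-y+y≈x x = ≈-trans (+-assoc x (- ε) ε) (≈-trans (+-congˡ (-‿inverseˡ ε)) (+-identityʳ x))

    0≤w : 0# ≤ w
    0≤w = *-nonneg (inj₁ 0<ε) 0≤opt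

    opt≤Kw : opt ≤ K · w
    opt≤Kw = ≤-trans (≤-reflexive (≈-sym (*-identityʳ opt))) (≤-trans (*-monoʳ-≤ 0≤opt 1≤Kε)
      (≤-reflexive (≈-trans (·-comm-* K opt ε) (×-congʳ K (*-comm opt ε)))))

    y≤Kw : y ≤ K · w
    -- `·-cancelˡ-≤` cancels the successor of its argument, so the factor removed is 3.
    y≤Kw = ·-cancelˡ-≤ 2 (begin
      3 · y             ≈⟨ +-identityʳ _ ⟨
      3 · y + 0#        ≤⟨ +-monoʳ-≤ (3 · y) (·-nonneg 3 0≤w) ⟩
      3 · y + 3 · w     ≈⟨ opt≈3y+3w ⟨
      opt               ≤⟨ opt≤Kw ⟩
      K · w             ≈⟨ ×-homo-1 (K · w) ⟨
      1 · (K · w)       ≤⟨ ·-monoˡ-≤ {1} {3} (·-nonneg K 0≤w) (ℕ.s≤s ℕ.z≤n) ⟩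
      3 · (K · w)       ∎)
      where open ≤-Reasoning

    Kw≤3Kw : K · w ≤ (K ℕ.* 3) · w
    Kw≤3Kw = ·-monoˡ-≤ 0≤w (ℕ.m≤m*n K 3)

    Kopt≈ : K · opt ≈ (K ℕ.* 3) · w + (K ℕ.* 3) · y
    Kopt≈ = begin
      K · opt                                ≈⟨ ×-congʳ K (≈-trans opt≈3y+3w (+-comm _ _)) ⟩
      K · (3 · w + 3 · y)                    ≈⟨ ·-distribˡ-+ K _ _ ⟩
      K · (3 · w) + K · (3 · y)              ≈⟨ +-cong (×-assocˡ w K 3) (×-assocˡ y K 3) ⟩
      (K ℕ.* 3) · w + (K ℕ.* 3) · y          ∎
      where open import Relation.Binary.Reasoning.Setoid setoid

  maximizer : ∀ {n} {P : Pred (Subset n) 0ℓ} → Decidable P → (f : Subset n → Carrier) →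
              (∃[ S ] P S × (∀ T → P T → f T ≤ f S)) ⊎ (∀ T → ¬ P T)
  maximizer {zero} P? f with P? []
  ... | yes p = inj₁ ([] , p , λ { [] _ → ≤-refl })
  ... | no ¬p = inj₂ λ { [] → ¬p }
  maximizer {suc n} P? f
    with maximizer (P? ∘ (inside ∷_)) (f ∘ (inside ∷_)) | maximizer (P? ∘ (outside ∷_)) (f ∘ (outside ∷_))
  ... | inj₂ ¬in            | inj₂ ¬out            = inj₂ λ { (true ∷ T) → ¬in T ; (false ∷ T) → ¬out T }
  ... | inj₁ (S , pS , max) | inj₂ ¬out            = inj₁ (inside ∷ S , pS , λ
    { (true ∷ T) → max T ; (false ∷ T) pT → contradiction pT (¬out T) })
  ... | inj₂ ¬in            | inj₁ (S , pS , max)  = inj₁ (outside ∷ S , pS , λ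
    { (true ∷ T) pT → contradiction pT (¬in T) ; (false ∷ T) → max T })
  ... | inj₁ (S , pS , max) | inj₁ (S′ , pS′ , max′) with ≤-total (f (inside ∷ S)) (f (outside ∷ S′))
  ...   | inj₁ ≤′ = inj₁ (outside ∷ S′ , pS′ , λ
    { (true ∷ T) pT → ≤-trans (max T pT) ≤′ ; (false ∷ T) → max′ T })
  ...   | inj₂ ≥′ = inj₁ (inside ∷ S , pS , λ
    { (true ∷ T) → max T ; (false ∷ T) pT → ≤-trans (max′ T pT) ≥′ })

-- Submodular inequalities for one round, and their sum over the rounds

module LocalOptimum {c ℓ₁ ℓ₂} (ℝ : Reals c ℓ₁ ℓ₂) {n} (f : Subset n → Reals.Carrier ℝ)
  (nonneg : NonNegative ℝ f) (symmetric : SymmetricFunction ℝ f) (submodular : Submodular ℝ f) where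
  open Reals ℝ renaming (refl to ≈-refl; sym to ≈-sym; trans to ≈-trans)
  open OrderedField ℝ
  open SemiringSolver commutativeSemiring using (solve; _:+_; _:=_)

  submodular′ : ∀ {S T U V} → S ∪ T ≡ U → S ∩ T ≡ V → f U + f V ≤ f S + f T
  submodular′ {S} {T} refl refl = submodular S T

  ∪-subadditive : ∀ {S T U} → S ∪ T ≡ U → f U ≤ f S + f T
  ∪-subadditive {S} {T} {U} S∪T≡U =
    ≤-trans (≤-reflexive (≈-sym (+-identityʳ (f U))))
      (≤-trans (+-monoʳ-≤ (f U) (nonneg (S ∩ T))) (submodular′ S∪T≡U refl))

  -- C splits into its parts inside and outside S. The complement of the outer part is S together
  -- with everything outside S ∪ C, so two uses of symmetry bound its value by f(S) + f(S ∪ C).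
  crossing : ∀ S C → f C ≤ f S + (f (S ∪ C) + f (S ∩ C))
  crossing S C = ≤-trans (∪-subadditive cover)
    (≤-trans (+-monoˡ-≤ (f (S ∩ C)) C∩∁S≤) (≤-reflexive (+-assoc _ _ _)))
    where
    cover : (C ∩ ∁ S) ∪ (S ∩ C) ≡ C
    cover = lookup-ext eq
      where
      eq : ∀ x → lookup ((C ∩ ∁ S) ∪ (S ∩ C)) x ≡ lookup C x
      eq x rewrite lookup-∪ (C ∩ ∁ S) (S ∩ C) x | lookup-∩ C (∁ S) x | lookup-∩ S C x | lookup-∁ S x
        with lookup S x | lookup C x
      ... | false | false = refl
      ... | false | true  = refl
      ... | true  | false = refl
      ... | true  | true  = refl

    cover-∁ : S ∪ ∁ (S ∪ C) ≡ ∁ (C ∩ ∁ S)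
    cover-∁ = lookup-ext eq
      where
      eq : ∀ x → lookup (S ∪ ∁ (S ∪ C)) x ≡ lookup (∁ (C ∩ ∁ S)) x
      eq x rewrite lookup-∪ S (∁ (S ∪ C)) x | lookup-∁ (S ∪ C) x | lookup-∪ S C x
                 | lookup-∁ (C ∩ ∁ S) x | lookup-∩ C (∁ S) x | lookup-∁ S x
        with lookup S x | lookup C x
      ... | false | false = refl
      ... | false | true  = refl
      ... | true  | false = refl
      ... | true  | true  = refl

    C∩∁S≤ : f (C ∩ ∁ S) ≤ f S + f (S ∪ C)
    C∩∁S≤ = ≤-trans (≤-reflexive (symmetric (C ∩ ∁ S)))
      (≤-trans (∪-subadditive cover-∁) (≤-reflexive (+-congˡ (≈-sym (symmetric (S ∪ C))))))

  module _ (M : Matroid n) {S : Subset n} (maxS : Maximum M S) where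
    open Matroid M

    module _ {F : Carrier} (swap≤F : ∀ b c → b ∈ S → c ∉ S → Independent (swap S b c) → f (swap S b c) ≤ F) where

      -- Induction on the number of elements of C outside S. An exchange moves C to `C′`, one
      -- element closer to S, and f(S ∪ C) + f(S ∩ C) exceeds the same sum for `C′` by at most F -
      -- f(S).
      ∪∩-bound : f S ≤ F → ∀ k {C} → Maximum M C → ∣ C ∩ ∁ S ∣ ≡ k →
                 f (S ∪ C) + f (S ∩ C) + k · f S ≤ f S + f S + k · F
      ∪∩-bound fS≤F k {C} maxC ∣C∖S∣≡k with any? (λ b → (b ∈? S) ×-dec ¬? (b ∈? C))
      -- S lies inside C and both have the same size, so they coincide; `f S ≤ F` settles the terms
      -- with `k`.
      ... | no S∖C≡∅ = +-mono-≤ (subst (λ T → f (S ∪ C) + f (S ∩ C) ≤ f S + f T) (sym S≡C) (submodular S C))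
                               (·-monoʳ-≤ k fS≤F)
        where
        S≡C : S ≡ C
        S≡C = ⊆∧∣∣≤⇒≡ (λ {x} x∈S → decidable-stable (x ∈? C) (λ x∉C → S∖C≡∅ (x , x∈S , x∉C)))
                       (ℕ.≤-reflexive (sym (Maximum⇒∣∣≡ M maxS maxC)))
      ... | yes (b , b∈S , b∉C)
        with symmetricExchange M (proj₁ maxS) (proj₁ maxC) (Maximum⇒∣∣≡ M maxS maxC) b∈S b∉C
      ...   | c , c∈C , c∉S , indS′ , indC′ = step k ∣C∖S∣≡k
        where
        C′ = swap C c b

        ∣C′∖S∣ : suc ∣ C′ ∩ ∁ S ∣ ≡ ∣ C ∩ ∁ S ∣
        ∣C′∖S∣ = trans (cong (suc ∘ ∣_∣) (swap-∩-∁ b∈S b∉C c∈C c∉S))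
                         (∣remove∣ (x∈p∩q⁺ (c∈C , x∉p⇒x∈∁p c∉S)))

        step : ∀ k → ∣ C ∩ ∁ S ∣ ≡ k → f (S ∪ C) + f (S ∩ C) + k · f S ≤ f S + f S + k · F
        step zero    eq = contradiction (trans ∣C′∖S∣ eq) λ ()
        -- Uncross S + c with S ∪ C′, S - b with S ∩ C′, and the swapped set with S. In the sum the
        -- values at S + c and S - b cancel, and the induction hypothesis removes those at S ∪ C′
        -- and S ∩ C′.
        step (suc k) eq = balance
          (+-mono-≤ (∪∩-bound fS≤F k (Maximum-resp M maxC indC′ (∣swap∣ c∈C b∉C)) (ℕ.suc-injective (trans ∣C′∖S∣ eq)))
          (+-mono-≤ (submodular′ (insert-∪-∪ b∈S b∉C c∈C c∉S) (insert-∩-∪ b∈S b∉C c∈C c∉S))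
          (+-mono-≤ (submodular′ (remove-∪-∩ b∈S b∉C c∈C c∉S) (remove-∩-∩ b∈S b∉C c∈C c∉S))
          (+-mono-≤ (submodular′ (swap-∪ b∈S b∉C c∈C c∉S) (swap-∩ b∈S b∉C c∈C c∉S))
                    (swap≤F b c b∈S c∉S indS′)))))
          (solve 11 (λ s ∪C ∩C ∪C′ ∩C′ s+c s-b s′ ks F kF →
             ∪C :+ ∩C :+ (s :+ ks) :+
               ((s :+ s :+ kF) :+ ((s+c :+ ∪C′) :+ ((s-b :+ ∩C′) :+ ((s′ :+ s) :+ F)))) :=
             s :+ s :+ (F :+ kF) :+
               ((∪C′ :+ ∩C′ :+ ks) :+ ((∪C :+ s) :+ ((s :+ ∩C) :+ ((s+c :+ s-b) :+ s′)))))
             ≈-refl (f S) (f (S ∪ C)) (f (S ∩ C)) (f (S ∪ C′)) (f (S ∩ C′)) (f (insert S c)) (f (remove S b))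
                  (f (swap S b c)) (k · f S) F (k · F))

      improvement-bound : f S ≤ F → ∀ {C} → Maximum M C → f C + n · f S ≤ 3 · f S + n · F
      improvement-bound fS≤F {C} maxC = balance
        -- The factor k depends on C; adding n - k further copies of f(S) ≤ F makes it n for every
        -- C.
        (+-mono-≤ (crossing S C) (+-mono-≤ (∪∩-bound fS≤F k maxC refl) (·-monoʳ-≤ (n ℕ.∸ k) fS≤F)))
        (≈-trans (+-congʳ (+-congˡ (split (f S)))) (≈-trans
          (solve 8 (λ c s ∪C ∩C ks k′s kF k′F →
             c :+ (ks :+ k′s) :+ (s :+ (∪C :+ ∩C) :+ ((s :+ s :+ kF) :+ k′F)) :=
             triple s :+ (kF :+ k′F) :+ (c :+ ((∪C :+ ∩C :+ ks) :+ k′s)))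
             ≈-refl (f C) (f S) (f (S ∪ C)) (f (S ∩ C)) (k · f S) ((n ℕ.∸ k) · f S) (k · F) ((n ℕ.∸ k) · F))
          (+-congʳ (+-congˡ (≈-sym (split F))))))
        where
        k = ∣ C ∩ ∁ S ∣
        split : ∀ x → n · x ≈ k · x + (n ℕ.∸ k) · x
        split x = ≈-trans (×-congˡ (sym (ℕ.m+[n∸m]≡n (∣p∣≤n (C ∩ ∁ S))))) (×-homo-+ x k (n ℕ.∸ k))

  -- Adding the two bounds cancels n v, which is the telescoping of the gains; the remaining 3 t + 3
  -- copies of v are raised to F.
  invariant-step : ∀ t {v F opt} → v ≤ F → opt + n · v ≤ 3 · v + n · F →
                   t · opt ≤ (t ℕ.* 3 ℕ.+ n) · v → suc t · opt ≤ (suc t ℕ.* 3 ℕ.+ n) · F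
  invariant-step t {v} {F} {opt} v≤F improve inv = balance
    (+-mono-≤ inv (+-mono-≤ improve (·-monoʳ-≤ (3 ℕ.+ t ℕ.* 3) v≤F)))
    (≈-trans (+-congˡ (+-congʳ (×-homo-+ v (t ℕ.* 3) n))) (≈-trans
      (solve 8 (λ o to v av nv F aF nF →
         o :+ to :+ (av :+ nv :+ (triple v :+ nF :+ (F :+ (F :+ (F :+ aF))))) :=
         F :+ (F :+ (F :+ (aF :+ nF))) :+ (to :+ (o :+ nv :+ (v :+ (v :+ (v :+ av))))))
         ≈-refl opt (t · opt) v ((t ℕ.* 3) · v) (n · v) F ((t ℕ.* 3) · F) (n · F))
      (+-congʳ (+-congˡ (+-congˡ (+-congˡ (≈-sym (×-homo-+ F (t ℕ.* 3) n))))))))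

  -- Since 3 K (n + 1) + n < (n + 1)(3 K + 1), the factor n + 1 cancels. Counting rounds in
  -- multiples of n + 1 instead of n keeps this valid for an empty ground set.
  invariant-conclusion : ∀ K {v opt} → 0# ≤ v →
    (K ℕ.* suc n) · opt ≤ (K ℕ.* suc n ℕ.* 3 ℕ.+ n) · v → K · opt ≤ suc (K ℕ.* 3) · v
  invariant-conclusion K {v} {opt} 0≤v inv = ·-cancelˡ-≤ n (begin
    suc n · (K · opt)                         ≈⟨ ×-assocˡ opt (suc n) K ⟩
    (suc n ℕ.* K) · opt                       ≈⟨ ×-congˡ (ℕ.*-comm (suc n) K) ⟩
    (K ℕ.* suc n) · opt                       ≤⟨ inv ⟩
    (K ℕ.* suc n ℕ.* 3 ℕ.+ n) · v             ≤⟨ ·-monoˡ-≤ 0≤v bound ⟩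
    (suc n ℕ.* suc (K ℕ.* 3)) · v             ≈⟨ ×-assocˡ v (suc n) (suc (K ℕ.* 3)) ⟨
    suc n · (suc (K ℕ.* 3) · v)               ∎)
    where
    open ≤-Reasoning
    open +-*-Solver using () renaming (solve to solveℕ; _:+_ to _⊞_; _:*_ to _⊠_; _:=_ to _≣_; con to lit′)
    bound : K ℕ.* suc n ℕ.* 3 ℕ.+ n ℕ.≤ suc n ℕ.* suc (K ℕ.* 3)
    bound = ℕ.≤-trans (ℕ.n≤1+n _) (ℕ.≤-reflexive (solveℕ 2 (λ k n →
      lit′ 1 ⊞ (k ⊠ (lit′ 1 ⊞ n) ⊠ lit′ 3 ⊞ n) ≣ (lit′ 1 ⊞ n) ⊠ (lit′ 1 ⊞ k ⊠ lit′ 3)) refl K n))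

-- The program

var : ℕ → NatExp
var a = a [ lit 0 ]

for_upTo_loop_ : ℕ → NatExp → Program → Program
for a upTo e loop p =
  a [ lit 0 ]≔ lit 0 ⨟
  while var a ≺ e loop (p ⨟ a [ lit 0 ]≔ var a ⊕ lit 1)

greedyStep greedy : Program
greedyStep =
  0 [ var 3 ]≔ lit 1 ⨟
  5 [ lit 0 ]≔independent 0 ⨟
  (ifᴾ lit 0 ≺ var 5 then skip else (0 [ var 3 ]≔ lit 0))
greedy = for 3 upTo size loop greedyStep

exchange : ℕ → ℕ → Program
exchange a b = 0 [ var a ]≔ lit 0 ⨟ 0 [ var b ]≔ lit 1

-- Array 0 holds the current set, arrays 3 and 4 the elements to be swapped,
-- arrays 1 and 2 the best swap so far, whose value is real 0, and array 5 the
-- last answer of the independence oracle; array 6 counts rounds.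
record-swap trySwap improve : Program
record-swap =
  1 [ lit 0 ]≔value 0 ⨟
  (ifᴾ 0 [ lit 0 ] ≺ᴿ 1 [ lit 0 ]
   then (0 [ lit 0 ]≔ᴿ 1 [ lit 0 ] ⨟ 1 [ lit 0 ]≔ var 3 ⨟ 2 [ lit 0 ]≔ var 4)
   else skip)
trySwap =
  ifᴾ lit 0 ≺ 0 [ var 3 ] then
    (ifᴾ lit 0 ≺ 0 [ var 4 ] then skip else
      (exchange 3 4 ⨟
       5 [ lit 0 ]≔independent 0 ⨟
       (ifᴾ lit 0 ≺ var 5 then record-swap else skip) ⨟
       exchange 4 3))
  else skip

-- The initial best swap, of n with n, does nothing, as n is not an element.
improve =
  1 [ lit 0 ]≔ size ⨟
  2 [ lit 0 ]≔ size ⨟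
  0 [ lit 0 ]≔value 0 ⨟
  for 3 upTo size loop (for 4 upTo size loop trySwap) ⨟
  exchange 1 2

-- The machine cannot multiply; as K is a constant of the program, the product K (n + 1) is unrolled
-- into a sum.
multiple : ℕ → NatExp
multiple zero    = lit 0
multiple (suc K) = (lit 1 ⊕ size) ⊕ multiple K

localSearch : ℕ → Program
localSearch K = greedy ⨟ for 6 upTo multiple K loop improve

-- Polynomial bounds on the number of steps

module RunningTime where
  open import Data.Nat.Base using (_+_; _*_; _^_; _≤_)

  -- The base is suc n because powers of zero are not monotone in the exponent.
  PolynomiallyBounded : (ℕ → ℕ) → Set
  PolynomiallyBounded g = ∃[ k ] ∃[ d ] (∀ n → g n ≤ k * suc n ^ d)

  bounded-const : ∀ a → PolynomiallyBounded (λ _ → a)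
  bounded-const a = a , 0 , λ n → ℕ.≤-reflexive (sym (ℕ.*-identityʳ a))

  bounded-id : PolynomiallyBounded (λ n → n)
  bounded-id = 1 , 1 , λ n → ℕ.≤-trans (ℕ.n≤1+n n)
    (ℕ.≤-reflexive (sym (trans (ℕ.*-identityˡ _) (ℕ.*-identityʳ (suc n)))))

  bounded-+ : ∀ {g h} → PolynomiallyBounded g → PolynomiallyBounded h → PolynomiallyBounded (λ n → g n + h n)
  bounded-+ {g} {h} (k , d , g≤) (l , e , h≤) = k + l , d + e , λ n → begin
    g n + h n                                       ≤⟨ ℕ.+-mono-≤ (g≤ n) (h≤ n) ⟩
    k * suc n ^ d + l * suc n ^ e                   ≤⟨ ℕ.+-mono-≤ (ℕ.*-monoʳ-≤ k (ℕ.^-monoʳ-≤ (suc n) (ℕ.m≤m+n d e)))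
                                                                  (ℕ.*-monoʳ-≤ l (ℕ.^-monoʳ-≤ (suc n) (ℕ.m≤n+m e d))) ⟩
    k * suc n ^ (d + e) + l * suc n ^ (d + e)       ≡⟨ ℕ.*-distribʳ-+ (suc n ^ (d + e)) k l ⟨
    (k + l) * suc n ^ (d + e)                       ∎
    where open ℕ.≤-Reasoning

  bounded-* : ∀ {g h} → PolynomiallyBounded g → PolynomiallyBounded h → PolynomiallyBounded (λ n → g n * h n)
  bounded-* {g} {h} (k , d , g≤) (l , e , h≤) = k * l , d + e , λ n → begin
    g n * h n                                       ≤⟨ ℕ.*-mono-≤ (g≤ n) (h≤ n) ⟩
    k * suc n ^ d * (l * suc n ^ e)                 ≡⟨ ℕ.[m*n]*[o*p]≡[m*o]*[n*p] k (suc n ^ d) l (suc n ^ e) ⟩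
    k * l * (suc n ^ d * suc n ^ e)                 ≡⟨ cong (k * l *_) (ℕ.^-distribˡ-+-* (suc n) d e) ⟨
    k * l * suc n ^ (d + e)                         ∎
    where open ℕ.≤-Reasoning

  ^-distribʳ-* : ∀ o m n → (m * n) ^ o ≡ m ^ o * n ^ o
  ^-distribʳ-* zero    m n = refl
  ^-distribʳ-* (suc o) m n = trans (cong (m * n *_) (^-distribʳ-* o m n)) (ℕ.[m*n]*[o*p]≡[m*o]*[n*p] m n (m ^ o) (n ^ o))

  -- For positive n, n + 1 ≤ 2 n costs a factor 2 ^ d; the additive constant takes care of n = 0.
  bounded⇒polynomial : ∀ {g} → PolynomiallyBounded g → ∃[ k ] ∃[ d ] (∀ n → g n ≤ k * n ^ d + k)
  bounded⇒polynomial {g} (k , d , g≤) = k * 2 ^ d , d , λ n → ℕ.≤-trans (g≤ n) (bound n)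
    where
    open ℕ.≤-Reasoning
    bound : ∀ n → k * suc n ^ d ≤ k * 2 ^ d * n ^ d + k * 2 ^ d
    bound zero = begin
      k * 1 ^ d         ≤⟨ ℕ.*-monoʳ-≤ k (ℕ.^-monoˡ-≤ d (s≤s z≤n)) ⟩
      k * 2 ^ d         ≤⟨ ℕ.m≤n+m _ _ ⟩
      _                 ∎
    bound (suc m) = begin
      k * suc (suc m) ^ d            ≤⟨ ℕ.*-monoʳ-≤ k (ℕ.^-monoˡ-≤ d 1+n≤2n) ⟩
      k * (2 * suc m) ^ d            ≡⟨ cong (k *_) (^-distribʳ-* d 2 (suc m)) ⟩
      k * (2 ^ d * suc m ^ d)        ≡⟨ ℕ.*-assoc k _ _ ⟨
      k * 2 ^ d * suc m ^ d          ≤⟨ ℕ.m≤m+n _ _ ⟩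
      _                              ∎
      where
      1+n≤2n : suc (suc m) ≤ 2 * suc m
      1+n≤2n = s≤s (ℕ.≤-trans (s≤s (ℕ.m≤m+n m 0)) (ℕ.m≤n+m _ m))

  -- One step initialises the counter, each of the m rounds adds a test and an increment to the t
  -- steps of the body, and the failing test costs one more.
  loopTime : ℕ → ℕ → ℕ
  loopTime t m = 1 + (m * suc (t + 1) + 1)

  -- 4 bounds `greedyStep`. 13 bounds `trySwap`: two membership tests, two exchanges of two steps,
  -- one query, and a test followed by at most five steps of `record-swap`.
  greedyTime improveTime : ℕ → ℕ
  greedyTime n = loopTime 4 n
  improveTime n = 3 + (loopTime (loopTime 13 n) n + 2)

  localSearchTime : ℕ → ℕ → ℕ
  localSearchTime K n = greedyTime n + loopTime (improveTime n) (K * suc n)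

  localSearchTime-bounded : ∀ K → PolynomiallyBounded (localSearchTime K)
  localSearchTime-bounded K =
    bounded-+ (bounded-loop (bounded-const 4) bounded-id)
              (bounded-loop bounded-improve
                (bounded-* (bounded-const K) (bounded-+ (bounded-const 1) bounded-id)))
    where
    bounded-loop : ∀ {t m} → PolynomiallyBounded t → PolynomiallyBounded m →
                   PolynomiallyBounded (λ n → loopTime (t n) (m n))
    bounded-loop bt bm = bounded-+ (bounded-const 1)
      (bounded-+ (bounded-* bm (bounded-+ (bounded-const 1) (bounded-+ bt (bounded-const 1)))) (bounded-const 1))
    bounded-improve : PolynomiallyBounded improveTime
    bounded-improve = bounded-+ (bounded-const 3)
      (bounded-+ (bounded-loop (bounded-loop (bounded-const 13) bounded-id) bounded-id) (bounded-const 2))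

open RunningTime

-- Array writes as operations on subsets

≡ᵇ-refl : ∀ k → (k ≡ᵇ k) ≡ true
≡ᵇ-refl k = Equivalence.to T-≡ (ℕ.≡⇒≡ᵇ k k refl)

≢⇒≡ᵇ : ∀ {k l} → k ≢ l → (k ≡ᵇ l) ≡ false
≢⇒≡ᵇ {k} {l} k≢l with k ≡ᵇ l in eq
... | true  = contradiction (ℕ.≡ᵇ⇒≡ k l (Equivalence.from T-≡ eq)) k≢l
... | false = refl

module _ {n : ℕ} where

  -- The position is a raw memory index, so that writes beyond the ground set are covered as well;
  -- they leave the set alone.
  put : Subset n → ℕ → Bool → Subset n
  put S k v = tabulate (λ x → if k ≡ᵇ toℕ x then v else lookup S x)

  decode-update : ∀ m i v → decode n (update m 0 i v 0) ≡ put (decode n (m 0)) i (0 <ᵇ v)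
  decode-update m i v = tabulate-cong eq
    where
    eq : ∀ x → (0 <ᵇ update m 0 i v 0 (toℕ x)) ≡ (if i ≡ᵇ toℕ x then 0 <ᵇ v else lookup (decode n (m 0)) x)
    eq x with i ≡ᵇ toℕ x
    ... | true  = refl
    ... | false = sym (lookup∘tabulate (λ x → 0 <ᵇ m 0 (toℕ x)) x)

  put-toℕ : ∀ S x v → put S (toℕ x) v ≡ S [ x ]↦ v
  put-toℕ S x v = lookup-ext λ y → trans (lookup∘tabulate _ y) (trans (eq y) (sym (lookup-update S x v y)))
    where
    eq : ∀ y → (if toℕ x ≡ᵇ toℕ y then v else lookup S y) ≡ (if does (y ≟ x) then v else lookup S y)
    eq y with y ≟ x
    ... | yes refl rewrite ≡ᵇ-refl (toℕ x) = refl
    ... | no y≢x   rewrite ≢⇒≡ᵇ (y≢x ∘ sym ∘ toℕ-injective) = refl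

  put-outOfRange : ∀ S v → put S n v ≡ S
  put-outOfRange S v = trans (tabulate-cong eq) (tabulate∘lookup S)
    where
    eq : ∀ x → (if n ≡ᵇ toℕ x then v else lookup S x) ≡ lookup S x
    eq x rewrite ≢⇒≡ᵇ (ℕ.>⇒≢ (toℕ<n x)) = refl

-- A program logic with time bounds, and the correctness of the search

module Verification {c ℓ₁ ℓ₂} (ℝ : Reals c ℓ₁ ℓ₂) {n : ℕ} (M : Matroid n) (f : Subset n → Reals.Carrier ℝ) where
  open import Data.Nat.Base using (_+_; _*_; _≤_)
  open Reals ℝ using (Carrier; 0#; _<?_) renaming (_≤_ to _≤ᴿ_)
  open OrderedField ℝ using (_·_; ·-nonneg; maximizer)
    renaming (≤-refl to ≤ᴿ-refl; ≤-trans to ≤ᴿ-trans; ≮⇒≥ to ≮ᴿ⇒≥)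
  open Matroid M
  open Execution ℝ M f
  open State

  -- A total-correctness triple. The time is only an upper bound, so branches of different lengths
  -- can share one.
  record Runs {q} (p : Program) (σ : State) (t : ℕ) (Q : State → Set q) : Set (c ⊔ q) where
    constructor runs
    field
      {final} : State
      {time}  : ℕ
      halts   : p , σ ⇓ final after time
      time≤   : time ≤ t
      holds   : Q final

  module _ {q} {Q : State → Set q} where

    runs-skip : ∀ {σ t} → Q σ → Runs skip σ (suc t) Q
    runs-skip Qσ = runs skip (s≤s z≤n) Qσ

    runs-≔ : ∀ {a e e′ σ} → Q (setℕ a e (evalℕ e′ σ) σ) → Runs (a [ e ]≔ e′) σ 1 Q
    runs-≔ Qτ = runs assignℕ ℕ.≤-refl Qτ

    runs-≔ᴿ : ∀ {a e r σ} → Q (setᴿ a e (evalᴿ r σ) σ) → Runs (a [ e ]≔ᴿ r) σ 1 Q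
    runs-≔ᴿ Qτ = runs assignᴿ ℕ.≤-refl Qτ

    runs-value : ∀ {a e b σ} → Q (setᴿ a e (f (query b σ)) σ) → Runs (a [ e ]≔value b) σ 1 Q
    runs-value Qτ = runs value ℕ.≤-refl Qτ

    runs-independent : ∀ {a e b σ} →
      Q (setℕ a e (if does (independent? (query b σ)) then 1 else 0) σ) → Runs (a [ e ]≔independent b) σ 1 Q
    runs-independent Qτ = runs independent ℕ.≤-refl Qτ

    -- A run of the second program serves as the postcondition of the first, so no intermediate
    -- assertion has to be named.
    runs-⨟ : ∀ {p r σ s t} → Runs p σ s (λ τ → Runs r τ t Q) → Runs (p ⨟ r) σ (s + t) Q
    runs-⨟ (runs p⇓ s≤ (runs r⇓ t≤ Qυ)) = runs (sequence p⇓ r⇓) (ℕ.+-mono-≤ s≤ t≤) Qυ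

    runs-if : ∀ {b p r σ t} → (test b σ ≡ true → Runs p σ t Q) → (test b σ ≡ false → Runs r σ t Q) →
              Runs (ifᴾ b then p else r) σ (suc t) Q
    runs-if {b} {σ = σ} then′ else′ with test b σ in eq
    ... | true  = let runs p⇓ s≤ Qτ = then′ refl in runs (if-true eq p⇓) (s≤s s≤) Qτ
    ... | false = let runs r⇓ s≤ Qτ = else′ refl in runs (if-false eq r⇓) (s≤s s≤) Qτ

  runs-weaken : ∀ {q r} {Q : State → Set q} {R : State → Set r} {p σ t} →
                Runs p σ t Q → (∀ {τ} → Q τ → R τ) → Runs p σ t R
  runs-weaken (runs p⇓ t≤ Qτ) Q⇒R = runs p⇓ t≤ (Q⇒R Qτ)

  module _ {q} (I : ℕ → State → Set q) {a e p m t} (e≡m : ∀ σ → evalℕ e σ ≡ m)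
    (step : ∀ {i σ} → i ℕ.< m → nats σ a 0 ≡ i → I i σ →
            Runs p σ t (λ τ → nats τ a 0 ≡ i × I (suc i) (setℕ a (lit 0) (nats τ a 0 + 1) τ)))
    where

    nats-setℕ : ∀ v σ → nats (setℕ a (lit 0) v σ) a 0 ≡ v
    nats-setℕ v σ rewrite ≡ᵇ-refl a = refl

    -- `k` counts the rounds left, which makes the recursion structural. The body has to return the
    -- counter unchanged; the invariant is demanded after the increment, as it may speak of the
    -- whole state.
    runs-while : ∀ k i {σ} → k + i ≡ m → nats σ a 0 ≡ i → I i σ →
                 Runs (while var a ≺ e loop (p ⨟ a [ lit 0 ]≔ var a ⊕ lit 1)) σ (k * suc (t + 1) + 1) (I m)
    runs-while zero i {σ} refl σa≡i Iσ = runs (while-false exit) (s≤s z≤n) Iσ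
      where
      exit : test (var a ≺ e) σ ≡ false
      exit rewrite σa≡i | e≡m σ = dec-false (i ℕ.<? i) (ℕ.<-irrefl refl)
    runs-while (suc k) i {σ} k+i≡m σa≡i Iσ
      with step i<m σa≡i Iσ
      where
      i<m : i ℕ.< m
      i<m = subst (i ℕ.<_) k+i≡m (s≤s (ℕ.m≤n+m i k))
    ... | runs {τ} p⇓ s≤ (τa≡i , Iτ)
      with runs-while k (suc i) (trans (ℕ.+-suc k i) k+i≡m)
             (trans (nats-setℕ (nats τ a 0 + 1) τ) (trans (cong (_+ 1) τa≡i) (ℕ.+-comm i 1))) Iτ
    ...   | runs r⇓ r≤ Iυ = runs (while-true enter (sequence p⇓ assignℕ) r⇓)
        (s≤s (ℕ.≤-trans (ℕ.+-mono-≤ (ℕ.+-monoˡ-≤ 1 s≤) r≤) (ℕ.≤-reflexive (sym (ℕ.+-assoc (t + 1) _ 1))))) Iυ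
      where
      enter : test (var a ≺ e) σ ≡ true
      enter rewrite σa≡i | e≡m σ = dec-true (i ℕ.<? m) (subst (i ℕ.<_) k+i≡m (s≤s (ℕ.m≤n+m i k)))

    runs-for : ∀ {σ} → I 0 (setℕ a (lit 0) 0 σ) → Runs (for a upTo e loop p) σ (loopTime t m) (I m)
    runs-for {σ} I0 = runs-⨟ (runs-≔ (runs-while m 0 (ℕ.+-identityʳ m) (nats-setℕ 0 σ) I0))

  query-setℕ : ∀ e v σ → query 0 (setℕ 0 e v σ) ≡ put (query 0 σ) (evalℕ e σ) (0 <ᵇ v)
  query-setℕ e v σ = decode-update (nats σ) (evalℕ e σ) v

  query-exchange : ∀ {a b σ} →
    query 0 (setℕ 0 (var (suc b)) 1 (setℕ 0 (var (suc a)) 0 σ)) ≡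
    put (put (query 0 σ) (nats σ (suc a) 0) outside) (nats σ (suc b) 0) inside
  query-exchange {a} {b} {σ} = trans (query-setℕ (var (suc b)) 1 (setℕ 0 (var (suc a)) 0 σ))
    (cong (λ S → put S (nats σ (suc b) 0) inside) (query-setℕ (var (suc a)) 0 σ))

  put-swap : ∀ {S : Subset n} {x y b c} → x ≡ toℕ b → y ≡ toℕ c →
             put (put S x outside) y inside ≡ swap S b c
  put-swap {S} {b = b} {c} refl refl = trans (put-toℕ _ c inside) (cong (λ T → insert T c) (put-toℕ S b outside))

  runs-exchange : ∀ {q} {Q : State → Set q} {a b σ} →
    Q (setℕ 0 (var b) 1 (setℕ 0 (var a) 0 σ)) → Runs (exchange a b) σ 2 Q
  runs-exchange Qτ = runs-⨟ (runs-≔ (runs-≔ Qτ))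

  flag-true : ∀ {S} → (0 <ᵇ (if does (independent? S) then 1 else 0)) ≡ true → Independent S
  flag-true {S} eq with independent? S
  ... | yes ind = ind

  flag-false : ∀ {S} → (0 <ᵇ (if does (independent? S) then 1 else 0)) ≡ false → ¬ Independent S
  flag-false {S} eq with independent? S
  ... | no ¬ind = ¬ind

  member-test : ∀ {a σ x} → nats σ a 0 ≡ toℕ x → test (lit 0 ≺ 0 [ var a ]) σ ≡ lookup (query 0 σ) x
  member-test {a} {σ} {x} eq = trans (cong (λ i → 0 <ᵇ nats σ 0 i) eq)
    (sym (lookup∘tabulate (λ x → 0 <ᵇ nats σ 0 (toℕ x)) x))

  <1+toℕ : ∀ {x y : Fin n} → toℕ x ℕ.< suc (toℕ y) → toℕ x ℕ.< toℕ y ⊎ x ≡ y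
  <1+toℕ {x} {y} (s≤s x≤y) with ℕ.m≤n⇒m<n∨m≡n x≤y
  ... | inj₁ x<y = inj₁ x<y
  ... | inj₂ x≡y = inj₂ (toℕ-injective x≡y)

  -- The greedy pass yields a base

  GreedyInvariant : ℕ → State → Set
  GreedyInvariant i σ =
    Independent (query 0 σ) × (∀ x → toℕ x ℕ.< i → x ∉ query 0 σ → ¬ Independent (insert (query 0 σ) x))

  -- Rejection is permanent: by heredity, an element that made a smaller set dependent also makes
  -- every larger one dependent. Hence a single pass reaches a maximal set.
  greedyStep-runs : ∀ {b σ} → nats σ 3 0 ≡ toℕ b → GreedyInvariant (toℕ b) σ →
    Runs greedyStep σ 4 (λ τ → nats τ 3 0 ≡ toℕ b × GreedyInvariant (suc (toℕ b)) τ)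
  greedyStep-runs {b} {σ} σ₃≡b (indS , maximal) =
    runs-⨟ (runs-≔ (runs-⨟ (runs-independent (runs-if accept reject))))
    where
    S = query 0 σ
    σ₁ = setℕ 0 (var 3) 1 σ
    σ₂ = setℕ 5 (lit 0) (if does (independent? (query 0 σ₁)) then 1 else 0) σ₁
    σ₃ = setℕ 0 (var 3) 0 σ₂

    S₁≡ : query 0 σ₁ ≡ insert S b
    S₁≡ = trans (query-setℕ (var 3) 1 σ)
      (trans (cong (λ i → put S i inside) σ₃≡b) (put-toℕ S b inside))

    Q : State → Set
    Q τ = nats τ 3 0 ≡ toℕ b × GreedyInvariant (suc (toℕ b)) τ

    accept : test (lit 0 ≺ var 5) σ₂ ≡ true → Runs skip σ₂ 1 Q
    accept eq = runs-skip (σ₃≡b , indS₁ , λ x x<1+b x∉S₁ → extends x x<1+b x∉S₁)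
      where
      indS₁ = flag-true eq
      S⊆S₁ : ∀ {x} → x ∈ S → x ∈ query 0 σ₁
      S⊆S₁ {x} x∈S = subst (x ∈_) (sym S₁≡) (∈-insert⁺ x∈S)
      extends : ∀ x → toℕ x ℕ.< suc (toℕ b) → x ∉ query 0 σ₁ → ¬ Independent (insert (query 0 σ₁) x)
      extends x x<1+b x∉S₁ ind with <1+toℕ x<1+b
      ... | inj₁ x<b  = maximal x x<b (x∉S₁ ∘ S⊆S₁)
                          (hereditary (insert-⊆ (∈-insert⁺ ∘ S⊆S₁) (x∈insert _ x)) ind)
      ... | inj₂ refl = x∉S₁ (subst (x ∈_) (sym S₁≡) (x∈insert S x))

    reject : test (lit 0 ≺ var 5) σ₂ ≡ false → Runs (0 [ var 3 ]≔ lit 0) σ₂ 1 Q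
    reject eq = runs-≔ {a = 0} {e = var 3} {e′ = lit 0} (σ₃≡b , subst Independent (sym S₃≡) indS ,
      λ x x<1+b x∉S₃ ind → extends x x<1+b (subst (x ∉_) S₃≡ x∉S₃) (subst (λ T → Independent (insert T x)) S₃≡ ind))
      where
      ¬ind : ¬ Independent (insert S b)
      ¬ind = flag-false eq ∘ subst Independent (sym S₁≡)
      -- Were b already in S, the tentative insertion would have changed nothing and stayed
      -- independent. Hence clearing the entry restores S.
      b∉S : b ∉ S
      b∉S b∈S = ¬ind (subst Independent (sym (∈⇒insert≡ b∈S)) indS)
      S₃≡ : query 0 σ₃ ≡ S
      S₃≡ = trans (query-setℕ (var 3) 0 σ₂) (trans (cong₂ (λ T i → put T i outside) S₁≡ σ₃≡b)
              (trans (put-toℕ (insert S b) b outside) (remove-insert b∉S)))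
      extends : ∀ x → toℕ x ℕ.< suc (toℕ b) → x ∉ S → ¬ Independent (insert S x)
      extends x x<1+b x∉S with <1+toℕ x<1+b
      ... | inj₁ x<b  = maximal x x<b x∉S
      ... | inj₂ refl = ¬ind

  query-initial : query 0 initial ≡ ⊥
  query-initial = tabulate-replicate
    where
    tabulate-replicate : ∀ {m} → tabulate {n = m} (λ _ → outside) ≡ ⊥
    tabulate-replicate {zero}  = refl
    tabulate-replicate {suc m} = cong (outside ∷_) tabulate-replicate

  greedy-runs : Runs greedy initial (greedyTime n) (λ τ → Maximum M (query 0 τ))
  greedy-runs = runs-weaken
    (runs-for GreedyInvariant {a = 3} {e = size} (λ _ → refl)
      (λ i<n σ₃≡i inv → step (toℕ-fromℕ< i<n) σ₃≡i inv)
      (subst Independent (sym query-initial) empty , λ _ ()))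
    (λ { (ind , maximal) → IsBase⇒Maximum M (maximal⇒IsBase M ind (λ x → maximal x (toℕ<n x))) })
    where
    step : ∀ {i σ} {b : Fin n} → toℕ b ≡ i → nats σ 3 0 ≡ i → GreedyInvariant i σ →
           Runs greedyStep σ 4 (λ τ → nats τ 3 0 ≡ i × GreedyInvariant (suc i) τ)
    step refl = greedyStep-runs

  -- One round: the search for the best exchange

  module _ (t : ℕ) (S : Subset n) where

    Seen : Set₁
    Seen = Fin n → Fin n → Set

    -- `Q` holds the pairs tried so far. The candidate is built by `put` from raw indices because
    -- both start at n, which names no element; until a swap is recorded the candidate is S itself.
    record Best (Q : Seen) (x y : ℕ) (v : Carrier) : Set (ℓ₁ ⊔ ℓ₂ ⊔ c) where
      candidate : Subset n
      candidate = put (put S x outside) y inside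
      field
        independent-candidate : Independent candidate
        ∣candidate∣           : ∣ candidate ∣ ≡ ∣ S ∣
        value≡                : v ≡ f candidate
        improves              : f S ≤ᴿ v
        dominates             : ∀ b c → Q b c → b ∈ S → c ∉ S → Independent (swap S b c) → f (swap S b c) ≤ᴿ v

    Best-resp : ∀ {P Q : Seen} {x y v} → (∀ b c → Q b c → P b c) → Best P x y v → Best Q x y v
    Best-resp Q⊆P best = record { Best best ; dominates = λ b c q → Best.dominates best b c (Q⊆P b c q) }

    Search : Seen → State → Set _
    Search Q σ = nats σ 6 0 ≡ t × query 0 σ ≡ S × Best Q (nats σ 1 0) (nats σ 2 0) (reals σ 0 0)

    module _ {Q : Seen} {b c : Fin n} where

      Q⁺ : Seen
      Q⁺ b′ c′ = Q b′ c′ ⊎ (b′ ≡ b × c′ ≡ c)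

      keep : ∀ {x y v} → (b ∈ S → c ∉ S → Independent (swap S b c) → f (swap S b c) ≤ᴿ v) →
             Best Q x y v → Best Q⁺ x y v
      keep swap≤v best = record { Best best ; dominates = λ where
        b c (inj₁ q)             → Best.dominates best b c q
        _ _ (inj₂ (refl , refl)) → swap≤v }

      renew : ∀ {x y v} → b ∈ S → c ∉ S → Independent (swap S b c) → v ≤ᴿ f (swap S b c) →
              Best Q x y v → Best Q⁺ (toℕ b) (toℕ c) (f (swap S b c))
      renew {v = v} b∈S c∉S ind v≤ best = record
        { independent-candidate = subst Independent (sym candidate≡) ind
        ; ∣candidate∣           = trans (cong ∣_∣ candidate≡) (∣swap∣ b∈S c∉S)
        ; value≡                = cong f (sym candidate≡)
        ; improves              = ≤ᴿ-trans (Best.improves best) v≤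
        ; dominates             = λ where
            b c (inj₁ q) b∈S c∉S ind → ≤ᴿ-trans (Best.dominates best b c q b∈S c∉S ind) v≤
            _ _ (inj₂ (refl , refl)) _ _ _ → ≤ᴿ-refl
        }
        where
        candidate≡ : put (put S (toℕ b) outside) (toℕ c) inside ≡ swap S b c
        candidate≡ = put-swap refl refl

      At : State → Set
      At σ = nats σ 3 0 ≡ toℕ b × nats σ 4 0 ≡ toℕ c

      Swapped : State → Set _
      Swapped σ = At σ × nats σ 6 0 ≡ t × query 0 σ ≡ swap S b c ×
        Best Q⁺ (nats σ 1 0) (nats σ 2 0) (reals σ 0 0)

      record-swap-runs : ∀ {σ} → At σ → nats σ 6 0 ≡ t → query 0 σ ≡ swap S b c →
        b ∈ S → c ∉ S → Independent (swap S b c) → Best Q (nats σ 1 0) (nats σ 2 0) (reals σ 0 0) →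
        Runs record-swap σ 5 Swapped
      record-swap-runs {σ} at σ₆≡t query≡ b∈S c∉S ind best = runs-⨟ (runs-value {a = 1} (runs-if better worse))
        where
        σ₁ = setᴿ 1 (lit 0) (f (query 0 σ)) σ

        better : test (0 [ lit 0 ] ≺ᴿ 1 [ lit 0 ]) σ₁ ≡ true →
                 Runs (0 [ lit 0 ]≔ᴿ 1 [ lit 0 ] ⨟ 1 [ lit 0 ]≔ var 3 ⨟ 2 [ lit 0 ]≔ var 4) σ₁ 3 Swapped
        better eq with reals σ 0 0 <? f (query 0 σ)
        ... | yes v<f = runs-⨟ (runs-≔ᴿ {a = 0} (runs-⨟ (runs-≔ {a = 1} (runs-≔ {a = 2}
            (at , σ₆≡t , query≡ , best′)))))
          where
          best′ : Best Q⁺ (nats σ 3 0) (nats σ 4 0) (f (query 0 σ))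
          best′ rewrite proj₁ at | proj₂ at | query≡ = renew b∈S c∉S ind (inj₁ v<f) best

        worse : test (0 [ lit 0 ] ≺ᴿ 1 [ lit 0 ]) σ₁ ≡ false → Runs skip σ₁ 3 Swapped
        worse eq with reals σ 0 0 <? f (query 0 σ)
        ... | no v≮f = runs-skip (at , σ₆≡t , query≡ ,
          keep (λ _ _ _ → subst (λ T → f T ≤ᴿ reals σ 0 0) query≡ (≮ᴿ⇒≥ v≮f)) best)

      trySwap-runs : ∀ {σ} → At σ → Search Q σ → Runs trySwap σ 13 (λ τ → At τ × Search Q⁺ τ)
      trySwap-runs {σ} at@(σ₃≡b , σ₄≡c) (σ₆≡t , σ₀≡S , best) = runs-if
        (λ b-eq → runs-if
          (λ c-eq → runs-skip (unchanged λ _ c∉S _ → contradiction (c∈ c-eq) c∉S))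
          (λ c-eq → attempt (b∈ b-eq) (c∉ c-eq)))
        (λ b-eq → runs-skip (unchanged λ b∈S _ _ → contradiction b∈S (b∉ b-eq)))
        where
        unchanged : (b ∈ S → c ∉ S → Independent (swap S b c) → f (swap S b c) ≤ᴿ reals σ 0 0) →
                    At σ × Search Q⁺ σ
        unchanged swap≤v = at , σ₆≡t , σ₀≡S , keep swap≤v best

        b-test : ∀ {v} → test (lit 0 ≺ 0 [ var 3 ]) σ ≡ v → lookup S b ≡ v
        b-test eq = subst (λ T → lookup T b ≡ _) σ₀≡S (trans (sym (member-test {a = 3} {σ = σ} σ₃≡b)) eq)
        c-test : ∀ {v} → test (lit 0 ≺ 0 [ var 4 ]) σ ≡ v → lookup S c ≡ v
        c-test eq = subst (λ T → lookup T c ≡ _) σ₀≡S (trans (sym (member-test {a = 4} {σ = σ} σ₄≡c)) eq)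

        b∈ : _ → b ∈ S
        b∈ eq = lookup⇒[]= b S (b-test eq)
        b∉ : _ → b ∉ S
        b∉ eq = lookup⇒∉ (b-test eq)
        c∈ : _ → c ∈ S
        c∈ eq = lookup⇒[]= c S (c-test eq)
        c∉ : _ → c ∉ S
        c∉ eq = lookup⇒∉ (c-test eq)

        σ₁ = setℕ 0 (var 4) 1 (setℕ 0 (var 3) 0 σ)
        σ₂ = setℕ 5 (lit 0) (if does (independent? (query 0 σ₁)) then 1 else 0) σ₁

        query₁ : query 0 σ₁ ≡ swap S b c
        query₁ = trans (query-exchange {σ = σ}) (trans (put-swap σ₃≡b σ₄≡c) (cong (λ T → swap T b c) σ₀≡S))

        attempt : b ∈ S → c ∉ S → Runs (exchange 3 4 ⨟ 5 [ lit 0 ]≔independent 0 ⨟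
          (ifᴾ lit 0 ≺ var 5 then record-swap else skip) ⨟ exchange 4 3) σ 11 (λ τ → At τ × Search Q⁺ τ)
        attempt b∈S c∉S = runs-⨟ (runs-exchange {a = 3} {b = 4} (runs-⨟ (runs-independent {a = 5} (runs-⨟ (runs-weaken
          (runs-if {t = 5}
            (λ eq → record-swap-runs at σ₆≡t query₁ b∈S c∉S (subst Independent query₁ (flag-true eq)) best)
            (λ eq → runs-skip (at , σ₆≡t , query₁ ,
              keep (λ _ _ ind → contradiction (subst Independent (sym query₁) ind) (flag-false eq)) best)))
          restore)))))
          where
          -- The trial edits the current set in place, so it has to be undone. Swapping back is an
          -- inverse because the two membership tests gave b ∈ S and c ∉ S.
          restore : ∀ {τ} → Swapped τ → Runs (exchange 4 3) τ 2 (λ τ → At τ × Search Q⁺ τ)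
          restore {τ} (at′ , τ₆≡t , query≡ , best′) = runs-exchange {a = 4} {b = 3} (at′ , τ₆≡t , query₃ , best′)
            where
            query₃ : query 0 (setℕ 0 (var 3) 1 (setℕ 0 (var 4) 0 τ)) ≡ S
            query₃ = trans (query-exchange {σ = τ}) (trans (put-swap (proj₂ at′) (proj₁ at′))
              (trans (cong (λ T → swap T c b) query≡) (swap-inverse b∈S c∉S)))

    -- Lexicographic order: the pairs already tried when the outer counter is i and the inner one j.
    -- A finished row, with j = n, covers all that `Before (suc i) 0` demands.
    Before : ℕ → ℕ → Seen
    Before i j b c = toℕ b ℕ.< i ⊎ (toℕ b ≡ i × toℕ c ℕ.< j)

    Search-resp : ∀ {P Q : Seen} {σ} → (∀ b c → Q b c → P b c) → Search P σ → Search Q σ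
    Search-resp Q⊆P (σ₆≡t , σ₀≡S , best) = σ₆≡t , σ₀≡S , Best-resp Q⊆P best

    row-runs : ∀ {i σ} → i ℕ.< n → nats σ 3 0 ≡ i → Search (Before i 0) σ →
      Runs (for 4 upTo size loop trySwap) σ (loopTime 13 n) (λ τ → nats τ 3 0 ≡ i × Search (Before i n) τ)
    row-runs {i} i<n σ₃≡i search =
      runs-for (λ j σ → nats σ 3 0 ≡ i × Search (Before i j) σ) {a = 4} {e = size} (λ _ → refl)
        (λ j<n σ₄≡j (σ₃≡i , search) → step (toℕ-fromℕ< i<n) (toℕ-fromℕ< j<n) σ₃≡i σ₄≡j search)
        (σ₃≡i , search)
      where
      step : ∀ {i j σ} {b c : Fin n} → toℕ b ≡ i → toℕ c ≡ j → nats σ 3 0 ≡ i → nats σ 4 0 ≡ j →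
             Search (Before i j) σ →
             Runs trySwap σ 13 (λ τ → nats τ 4 0 ≡ j × nats τ 3 0 ≡ i × Search (Before i (suc j)) τ)
      step {b = b} {c} refl refl σ₃≡b σ₄≡c search = runs-weaken (trySwap-runs (σ₃≡b , σ₄≡c) search)
        λ {τ} ((τ₃≡b , τ₄≡c) , search′) → τ₄≡c , τ₃≡b , Search-resp {σ = τ} covered search′
        where
        covered : ∀ b′ c′ → Before (toℕ b) (suc (toℕ c)) b′ c′ → Before (toℕ b) (toℕ c) b′ c′ ⊎ (b′ ≡ b × c′ ≡ c)
        covered b′ c′ (inj₁ b′<b) = inj₁ (inj₁ b′<b)
        covered b′ c′ (inj₂ (b′≡b , c′<1+c)) with <1+toℕ c′<1+c
        ... | inj₁ c′<c = inj₁ (inj₂ (b′≡b , c′<c))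
        ... | inj₂ c′≡c = inj₂ (toℕ-injective b′≡b , c′≡c)

    -- The last two parts are hypotheses of `improvement-bound` with F = f(S′); the first two let S′
    -- inherit `Maximum` from S.
    Improvement : Subset n → Set _
    Improvement S′ = Independent S′ × ∣ S′ ∣ ≡ ∣ S ∣ × f S ≤ᴿ f S′ ×
      (∀ b c → b ∈ S → c ∉ S → Independent (swap S b c) → f (swap S b c) ≤ᴿ f S′)

    improve-runs : ∀ {σ} → nats σ 6 0 ≡ t → query 0 σ ≡ S → Independent S →
      Runs improve σ (improveTime n) (λ τ → nats τ 6 0 ≡ t × Improvement (query 0 τ))
    improve-runs {σ} σ₆≡t σ₀≡S indS =
      runs-⨟ (runs-≔ {a = 1} (runs-⨟ (runs-≔ {a = 2} (runs-⨟ (runs-value {a = 0} (runs-⨟ (runs-weaken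
        (runs-for (λ i → Search (Before i 0)) {a = 3} {e = size} (λ _ → refl)
          (λ {i} i<n σ₃≡i search → runs-weaken (row-runs i<n σ₃≡i search)
            λ {τ} (τ₃≡i , search′) → τ₃≡i , Search-resp {σ = τ} (row-complete i) search′)
          (σ₆≡t , σ₀≡S , start))
        finish)))))))
      where
      row-complete : ∀ i b c → Before (suc i) 0 b c → Before i n b c
      row-complete i b c (inj₁ (s≤s b≤i)) with ℕ.m≤n⇒m<n∨m≡n b≤i
      ... | inj₁ b<i = inj₁ b<i
      ... | inj₂ b≡i = inj₂ (b≡i , toℕ<n c)

      start : Best (Before 0 0) n n (f (query 0 σ))
      start = record
        { independent-candidate = subst Independent (sym candidate≡S) indS
        ; ∣candidate∣           = cong ∣_∣ candidate≡S
        ; value≡                = cong f (trans σ₀≡S (sym candidate≡S))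
        ; improves              = subst (λ T → f S ≤ᴿ f T) (sym σ₀≡S) ≤ᴿ-refl
        ; dominates             = λ { _ _ (inj₁ ()) ; _ _ (inj₂ (_ , ())) }
        }
        where
        candidate≡S : put (put S n outside) n inside ≡ S
        candidate≡S = trans (put-outOfRange _ inside) (put-outOfRange S outside)

      finish : ∀ {τ} → Search (Before n 0) τ →
               Runs (exchange 1 2) τ 2 (λ υ → nats υ 6 0 ≡ t × Improvement (query 0 υ))
      finish {τ} (τ₆≡t , τ₀≡S , best) = runs-exchange {a = 1} {b = 2} (τ₆≡t , subst Improvement (sym query≡) improvement)
        where
        open Best best
        query≡ : query 0 (setℕ 0 (var 2) 1 (setℕ 0 (var 1) 0 τ)) ≡ candidate
        query≡ = trans (query-exchange {σ = τ})
          (cong (λ T → put (put T (nats τ 1 0) outside) (nats τ 2 0) inside) τ₀≡S)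
        improvement : Improvement candidate
        improvement = independent-candidate , ∣candidate∣ , subst (f S ≤ᴿ_) value≡ improves ,
          λ b c b∈S c∉S ind → subst (f (swap S b c) ≤ᴿ_) value≡ (dominates b c (inj₁ (toℕ<n b)) b∈S c∉S ind)

  -- All rounds together, and the final guarantee

  evalℕ-multiple : ∀ K σ → evalℕ (multiple K) σ ≡ K * suc n
  evalℕ-multiple zero    σ = refl
  evalℕ-multiple (suc K) σ = cong (suc n +_) (evalℕ-multiple K σ)

  -- `IsBase` quantifies over all sets; independence together with the size of the greedy base is a
  -- decidable substitute, over which a finite search finds the optimum.
  maximumBase : ∃[ B ] Maximum M B × (∀ T → IsBase T → f T ≤ᴿ f B)
  maximumBase = choose (maximizer (λ T → independent? T ×-dec (∣ T ∣ ℕ.≟ ∣ G ∣)) f)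
    where
    G : Subset n
    G = query 0 (Runs.final greedy-runs)
    maxG : Maximum M G
    maxG = Runs.holds greedy-runs
    Full : Pred (Subset n) 0ℓ
    Full T = Independent T × ∣ T ∣ ≡ ∣ G ∣
    choose : (∃[ B ] Full B × (∀ T → Full T → f T ≤ᴿ f B)) ⊎ (∀ T → ¬ Full T) →
             ∃[ B ] Maximum M B × (∀ T → IsBase T → f T ≤ᴿ f B)
    choose (inj₂ none) = contradiction (proj₁ maxG , refl) (none G)
    choose (inj₁ (B , (indB , ∣B∣≡∣G∣) , f≤fB)) = B , Maximum-resp M maxG indB ∣B∣≡∣G∣ ,
      λ T baseT → f≤fB T (proj₁ baseT , Maximum⇒∣∣≡ M (IsBase⇒Maximum M baseT) maxG)

  module _ (nonneg : NonNegative ℝ f) (symmetric : SymmetricFunction ℝ f) (submodular : Submodular ℝ f) where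

    open LocalOptimum ℝ f nonneg symmetric submodular

    localSearch-runs : ∀ K {B} → Maximum M B → Runs (localSearch K) initial (localSearchTime K n)
      (λ τ → Maximum M (query 0 τ) × (K * suc n) · f B ≤ᴿ (K * suc n * 3 + n) · f (query 0 τ))
    localSearch-runs K {B} maxB = runs-⨟ (runs-weaken greedy-runs λ {σ} maxS →
      runs-for I {a = 6} {e = multiple K} (evalℕ-multiple K)
        (λ {t} {σ} _ σ₆≡t (maxS , inv) → runs-weaken (improve-runs t (query 0 σ) σ₆≡t refl (proj₁ maxS))
          λ (τ₆≡t , indS′ , ∣S′∣≡∣S∣ , fS≤ , swap≤) → τ₆≡t , Maximum-resp M maxS indS′ ∣S′∣≡∣S∣ ,
            invariant-step t fS≤ (improvement-bound M maxS swap≤ fS≤ maxB) inv)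
        -- Before the first round the inequality reads 0 ≤ n f(S), so nonnegativity alone starts the
        -- induction.
        (maxS , ·-nonneg n (nonneg (query 0 σ))))
      where
      I : ℕ → State → Set _
      I t σ = Maximum M (query 0 σ) × t · f B ≤ᴿ (t * 3 + n) · f (query 0 σ)

    localSearch-approximates : ∀ K →
      ∃[ S ] ∃[ t ] Returns (localSearch K) S t × t ≤ localSearchTime K n × IsBase S ×
        (∃[ opt ] IsMaximumOver ℝ IsBase f opt × 0# ≤ᴿ opt × K · opt ≤ᴿ suc (K * 3) · f S)
    localSearch-approximates K = query 0 final , time , (final , halts , refl) , time≤ ,
      Maximum⇒IsBase M (proj₁ holds) , f B , ((B , Maximum⇒IsBase M maxB , Reals.refl ℝ) , f≤fB) , nonneg B ,
      invariant-conclusion K (nonneg (query 0 final)) (proj₂ holds)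
      where
      B : Subset n
      B = proj₁ maximumBase
      maxB : Maximum M B
      maxB = proj₁ (proj₂ maximumBase)
      f≤fB : ∀ T → IsBase T → f T ≤ᴿ f B
      f≤fB = proj₂ (proj₂ maximumBase)
      open Runs (localSearch-runs K maxB)

theorem21 : ∀ {c ℓ₁ ℓ₂} (ℝ : Reals c ℓ₁ ℓ₂) →
    let open Reals ℝ in
    (ε : Carrier) → 0# < ε →
    ∃[ A ] IsPolynomialTimeApproximation ℝ ((1# + 1# + 1#) ⁻¹ - ε) A
theorem21 ℝ ε 0<ε = choose (archimedean 0<ε)
  where
  open Reals ℝ
  open OrderedField ℝ

  choose : ∃[ K ] 1# ≤ K · ε → ∃[ A ] IsPolynomialTimeApproximation ℝ ((1# + 1# + 1#) ⁻¹ - ε) A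
  choose (K , 1≤Kε) = localSearch K , approximates (bounded⇒polynomial (localSearchTime-bounded K))
    where
    approximates : ∃[ k ] ∃[ d ] (∀ n → localSearchTime K n ℕ.≤ k ℕ.* n ℕ.^ d ℕ.+ k) →
                   IsPolynomialTimeApproximation ℝ ((1# + 1# + 1#) ⁻¹ - ε) (localSearch K)
    -- The factor and the degree come from K alone, before any instance is given.
    approximates (k , d , time≤poly) = k , d , λ n M f nonneg symmetric submodular →
      let S , t , returns , t≤ , base , opt , maximum , 0≤opt , Kopt≤ =
            Verification.localSearch-approximates ℝ M f nonneg symmetric submodular K
      in S , t , returns , ℕ.≤-trans t≤ (time≤poly n) , base , opt , maximum ,
         approximation-ratio {K = K} 0<ε 1≤Kε 0≤opt Kopt≤
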